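{- Let $G$ be any graph on $n$ vertices with maximum degree $\Delta=\Delta(G)\ge 3$, let $H=L(G)$ be its line graph, and let $H^c$ be the complement of $H$. Then $\mathrm{box}(H^c)\le n-2$. Moreover: (i) if $\Delta=3$, then $\mathrm{box}(H^c)\ge \dfrac{|E(H)|}{12}$; (ii) if $\Delta=4$, then $\mathrm{box}(H^c)\ge \dfrac{|E(H)|}{16}$; (iii) if $\Delta\ge 5$, then $\mathrm{box}(H^c)\ge \dfrac{2|E(H)|}{\Delta^2+3\Delta}$.
   Context: Graphs are finite and simple. An axis-parallel $d$-dimensional box is a cartesian product $I_1\times I_2\times\dots\times I_d$ where each $I_i$ is a closed sub-interval of the real line (the whole line $\mathbb R$ is allowed). For a graph $F=(V,E)$, the boxicity $\mathrm{box}(F)$ is the minimum dimension $d\geq 0$ such that $F$ is the intersection graph of a family $(B_v)_{v\in V}$ of $d$-dimensional axis-parallel boxes in $\mathbb R^d$, i.e. distinct $u,v\in V$ are adjacent if and only if $B_u\cap B_v\ne\varnothing$. The line graph $L(G)$ of $G$ has vertex set $E(G)$, two distinct edges of $G$ being adjacent in $L(G)$ if they share an endvertex. -}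

module Defs where

open import Data.Fin as Fin using (Fin)
open import Data.Fin.Properties using (any?)
open import Data.List using (List; length; map; filter; allFin; cartesianProduct; lookup)
open import Data.List.Extrema.Nat using (max)
open import Data.Nat as ℕ using (ℕ)
open import Data.Product using (_×_; _,_; proj₁; proj₂; ∃-syntax; Σ-syntax)
open import Data.Rational as ℚ using (ℚ)
open import Data.Sum using (_⊎_)
open import Data.Unit using (⊤)
open import Data.Vec.Functional using (Vector)
open import Function.Bundles using (_⇔_)
open import Level using (0ℓ)
open import Relation.Binary using (Rel; Symmetric; Irreflexive; Decidable)
open import Relation.Binary.PropositionalEquality using (_≡_; _≢_; sym)
open import Relation.Nullary using (¬_)
open import Relation.Nullary.Decidable using (_×-dec_; _⊎-dec_; ¬?)
open import Relation.Unary using (Pred; _∈_; _⊆_)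

-- Real numbers as two-sided, located Dedekind cuts of ℚ.  Classically
-- this is the usual real line.
record ℝ : Set₁ where
  field
    L U         : Pred ℚ 0ℓ
    L-inhabited : ∃[ q ] q ∈ L
    U-inhabited : ∃[ q ] q ∈ U
    L-rounded   : ∀ q → q ∈ L ⇔ (∃[ r ] (q ℚ.< r × r ∈ L))
    U-rounded   : ∀ q → q ∈ U ⇔ (∃[ r ] (r ℚ.< q × r ∈ U))
    disjoint    : ∀ q → ¬ (q ∈ L × q ∈ U)
    located     : ∀ q r → q ℚ.< r → q ∈ L ⊎ r ∈ U

infix 4 _≤ᴿ_
_≤ᴿ_ : Rel ℝ 0ℓ
x ≤ᴿ y = ℝ.L x ⊆ ℝ.L y

-- Nonempty closed intervals, bounded or not.
data Interval : Set₁ where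
  bounded : (a b : ℝ) → a ≤ᴿ b → Interval
  from    : ℝ → Interval
  upTo    : ℝ → Interval
  line    : Interval

infix 4 _∈ᴵ_
_∈ᴵ_ : ℝ → Interval → Set
x ∈ᴵ bounded a b _ = a ≤ᴿ x × x ≤ᴿ b
x ∈ᴵ from a        = a ≤ᴿ x
x ∈ᴵ upTo b        = x ≤ᴿ b
x ∈ᴵ line          = ⊤

Box : ℕ → Set₁
Box d = Vector Interval d

infix 4 _∈ᴮ_
_∈ᴮ_ : ∀ {d} → Vector ℝ d → Box d → Set
x ∈ᴮ B = ∀ i → x i ∈ᴵ B i

Intersect : ∀ {d} → Box d → Box d → Set₁
Intersect B C = ∃[ x ] (x ∈ᴮ B × x ∈ᴮ C)

record Graph (n : ℕ) : Set₁ where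
  infix 4 _~_ _~?_
  field
    _~_      : Rel (Fin n) 0ℓ
    ~-sym    : Symmetric _~_
    ~-irrefl : Irreflexive _≡_ _~_
    _~?_     : Decidable _~_

module _ {n : ℕ} (G : Graph n) where
  open Graph G

  degree : Fin n → ℕ
  degree v = length (filter (v ~?_) (allFin n))

  maxDegree : ℕ
  maxDegree = max 0 (map degree (allFin n))

  -- Each edge {i , j} is listed exactly once, as the pair with i < j.
  edges : List (Fin n × Fin n)
  edges = filter (λ (i , j) → (i Fin.<? j) ×-dec (i ~? j))
                 (cartesianProduct (allFin n) (allFin n))

  ∣E∣ : ℕ
  ∣E∣ = length edges

  complement : Graph n
  complement = record
    { _~_      = λ u v → u ≢ v × ¬ (u ~ v)
    ; ~-sym    = λ (u≢v , u≁v) → (λ v≡u → u≢v (sym v≡u)) , (λ v~u → u≁v (~-sym v~u))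
    ; ~-irrefl = λ u≡v (u≢v , _) → u≢v u≡v
    ; _~?_     = λ u v → ¬? (u Fin.≟ v) ×-dec ¬? (u ~? v)
    }

  -- The vertices of the line graph are the positions in the list of edges.
  IsEndOf : Fin n → Fin ∣E∣ → Set
  IsEndOf v e = v ≡ proj₁ (lookup edges e) ⊎ v ≡ proj₂ (lookup edges e)

  isEndOf? : Decidable IsEndOf
  isEndOf? v e = (v Fin.≟ proj₁ (lookup edges e)) ⊎-dec (v Fin.≟ proj₂ (lookup edges e))

  lineGraph : Graph ∣E∣
  lineGraph = record
    { _~_      = λ e f → e ≢ f × (∃[ v ] (IsEndOf v e × IsEndOf v f))
    ; ~-sym    = λ (e≢f , v , v∈e , v∈f) → (λ f≡e → e≢f (sym f≡e)) , v , v∈f , v∈e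
    ; ~-irrefl = λ e≡f (e≢f , _) → e≢f e≡f
    ; _~?_     = λ e f → ¬? (e Fin.≟ f) ×-dec any? (λ v → isEndOf? v e ×-dec isEndOf? v f)
    }

  HasBoxRepresentation : ℕ → Set₁
  HasBoxRepresentation d =
    Σ[ B ∈ (Fin n → Box d) ] (∀ u v → u ≢ v → u ~ v ⇔ Intersect (B u) (B v))

  -- b is the minimum dimension of a box representation.  Minimality makes
  -- b unique; it is a relation because the minimum has to be shown to exist.
  IsBoxicity : ℕ → Set₁
  IsBoxicity b = HasBoxRepresentation b × (∀ d → HasBoxRepresentation d → b ℕ.≤ d)

module Submission where

open import Defs
open import Data.Bool using (Bool; T; T?)
open import Data.Empty using (⊥-elim)
open import Data.Fin as Fin using (Fin; zero; suc; toℕ; combine; remQuot)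
import Data.Fin.Properties as Fin
open import Data.Fin.Subset using (Subset)
open import Data.Fin.Subset.Properties using (anySubset?)
import Data.Integer as ℤ
import Data.Integer.Properties as ℤ
open import Data.List using (List; []; _∷_; length; map; lookup; filter; allFin; cartesianProduct)
open import Data.List.Extrema.Nat using (max; xs≤max; ⊥≤max; max<v⁺)
open import Data.List.Membership.Propositional using () renaming (_∈_ to _∈ₗ_)
open import Data.List.Membership.Propositional.Properties using (∈-lookup; ∈-filter⁺; ∈-filter⁻; ∈-allFin; ∈-map⁺)
open import Data.List.Relation.Unary.All as All using (All; []; _∷_)
import Data.List.Relation.Unary.All.Properties as All
open import Data.List.Relation.Unary.AllPairs using ([]; _∷_)
open import Data.List.Relation.Unary.Any using (here; there)
open import Data.List.Relation.Unary.Unique.Propositional using (Unique)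
import Data.List.Relation.Unary.Unique.Propositional.Properties as Unique
open import Data.Maybe using (Maybe; just; nothing)
open import Data.Nat as ℕ using (ℕ; zero; suc; _+_; _*_; _∸_; _^_; _⊔_; _≤_; _<_; z≤n; s≤s)
import Data.Nat.Coprimality as Coprimality
open import Data.Nat.Properties as ℕ using
  (≤-refl; ≤-trans; ≤-reflexive; +-mono-≤; +-suc; +-comm; ∸-monoˡ-≤; m≤m⊔n; m≤n⊔m)
open import Data.Nat.Tactic.RingSolver using (solve-∀)
open import Data.Product using (_×_; _,_; proj₁; proj₂; ∃-syntax)
open import Data.Rational as ℚ using (ℚ; mkℚ; 0ℚ; 1ℚ)
import Data.Rational.Properties as ℚ
open import Data.Sum as Sum using (_⊎_; inj₁; inj₂; swap)
open import Data.Unit using (⊤; tt)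
open import Data.Vec as Vec using (tabulate)
open import Data.Vec.Properties using (lookup∘tabulate)
open import Function using (_∘_; flip; case_of_)
open import Function.Bundles using (_⇔_; mk⇔; Equivalence)
open import Level using (0ℓ)
open import Relation.Binary using (Rel; Decidable; DecidableEquality; tri<; tri≈; tri>)
open import Relation.Binary.PropositionalEquality using
  (_≡_; _≢_; refl; sym; trans; cong; cong₂; subst; ≢-sym; module ≡-Reasoning)
open import Relation.Nullary using (¬_; Dec; yes; no; contradiction)
open import Relation.Nullary.Decidable using
  (⌊_⌋; _×-dec_; _⊎-dec_; _→-dec_; ¬?; map′; decidable-stable; ¬¬-excluded-middle; toWitness; fromWitness)
open import Relation.Unary using (Pred; _∪_; _⊆_)

-- The boxicity of F is the least number of interval orders whose comparabilities are exactly the non-edges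
-- of F: each coordinate contributes the relation "entirely to the left of". For boxes with real endpoints
-- this is clear up to double negation, and that suffices because the existence of such orders is decidable.
--
-- Upper bound: fix two vertices p and q and take one coordinate for each other vertex v; it separates the
-- edges at v from each other, vp from the other edges at p, and vq from the other edges at q.
--
-- Lower bound: let an interval order compare only adjacent vertices of L(G). Let e₁, e₂ be its two leftmost
-- elements by right endpoint and f₁, f₂ the two rightmost ones by left endpoint. The pairs e₁ ≺ f and e ≺ f₁
-- are counted by the neighbours of e₁ and f₁, the pairs e₂ ≺ f and e ≺ f₂ by the common neighbours of e₁, e₂
-- and of f₁, f₂. For any other pair e ≺ f each of e₁, e₂, e meets each of f₁, f₂, f, which forces these six
-- edges through one vertex, so e and f are among at most Δ − 4 further edges of a star.

-- Cardinality bounds for predicates.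

private variable
  A B : Set

-- Phrased with duplicate-free lists, so that a set can be bounded without deciding membership or
-- enumerating it.
record AtMost {A : Set} (P : Pred A 0ℓ) (k : ℕ) : Set where
  constructor atMost
  field
    bound : ∀ xs → Unique xs → All P xs → length xs ≤ k

open AtMost

module _ {P : Pred A 0ℓ} where

  atMost-≤ : ∀ {j k} → j ≤ k → AtMost P j → AtMost P k
  atMost-≤ j≤k Pj = atMost λ xs xs! Pxs → ≤-trans (bound Pj xs xs! Pxs) j≤k

  atMost-∅ : (∀ x → ¬ P x) → AtMost P 0
  atMost-∅ ¬P = atMost λ
    { []       _ _        → z≤n
    ; (x ∷ xs) _ (Px ∷ _) → contradiction Px (¬P x) }

  atMost-1 : (∀ {x y} → P x → P y → x ≡ y) → AtMost P 1
  atMost-1 P! = atMost λ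
    { []           _               _             → z≤n
    ; (x ∷ [])     _               _             → s≤s z≤n
    ; (x ∷ y ∷ xs) ((x≢y ∷ _) ∷ _) (Px ∷ Py ∷ _) → contradiction (P! Px Py) x≢y }

  -- The empty list obeys every bound, so an element of `P` may be assumed while bounding `P`.
  atMost-inhabited : ∀ {k} → (∀ x → P x → AtMost P k) → AtMost P k
  atMost-inhabited P→k = atMost λ
    { []       _   _            → z≤n
    ; (x ∷ xs) xs! Pxs@(Px ∷ _) → bound (P→k x Px) (x ∷ xs) xs! Pxs }

  atMost-⊆ : ∀ {Q : Pred A 0ℓ} {k} → Q ⊆ P → AtMost P k → AtMost Q k
  atMost-⊆ Q⊆P Pk = atMost λ xs xs! Qxs → bound Pk xs xs! (All.map Q⊆P Qxs)

  -- A nonempty list from `Q` stays duplicate-free within `P` when `x` is put in front. Membership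
  -- of `x` in `P` is only asked for once some `Q y` holds, so it may be derived from `Q y`.
  atMost-remove : ∀ {Q : Pred A 0ℓ} {k} (x : A) → AtMost P k →
                  (∀ y → Q y → P x × P y × x ≢ y) → AtMost Q (k ∸ 1)
  atMost-remove x Pk Q→ = atMost λ
    { []       _   _            → z≤n
    ; (y ∷ ys) ys! Qys@(Qy ∷ _) → ∸-monoˡ-≤ 1 (bound Pk (x ∷ y ∷ ys)
        (All.map (λ Qz → proj₂ (proj₂ (Q→ _ Qz))) Qys ∷ ys!)
        (proj₁ (Q→ y Qy) ∷ All.map (λ Qz → proj₁ (proj₂ (Q→ _ Qz))) Qys)) }

  atMost-image : ∀ {Q : Pred B 0ℓ} {k} (R : A → B → Set) →
                 (∀ x → P x → ∃[ y ] (Q y × R x y)) →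
                 (∀ {x x′ y} → P x → P x′ → R x y → R x′ y → x ≡ x′) →
                 AtMost Q k → AtMost P k
  atMost-image {B = B} {Q = Q} R total R-inj Qk = atMost λ xs xs! Pxs →
    let ys , ys! , Qys , len , _ = images xs xs! Pxs
    in ≤-trans (≤-reflexive (sym len)) (bound Qk ys ys! Qys)
    where
    -- Each image is returned with a preimage from the list: a repeated image would force a repeated
    -- preimage.
    images : ∀ xs → Unique xs → All P xs →
             ∃[ ys ] (Unique ys × All Q ys × length ys ≡ length xs ×
                      All (λ y → ∃[ x ] (x ∈ₗ xs × P x × R x y)) ys)
    images []       _            _          = [] , [] , [] , refl , []
    images (x ∷ xs) (x∉xs ∷ xs!) (Px ∷ Pxs)
      with y , Qy , xRy ← total x Px
      with ys , ys! , Qys , len , back ← images xs xs! Pxs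
      = y ∷ ys
      , All.map (λ { (x′ , x′∈xs , Px′ , x′Ry′) refl →
          All.lookup x∉xs x′∈xs (R-inj Px Px′ xRy x′Ry′) }) back ∷ ys!
      , Qy ∷ Qys
      , cong suc len
      , (x , here refl , Px , xRy)
        ∷ All.map (λ (x′ , x′∈xs , rest) → x′ , there x′∈xs , rest) back

atMost-∪ : ∀ {P Q : Pred A 0ℓ} {j k} → AtMost P j → AtMost Q k → AtMost (P ∪ Q) (j + k)
atMost-∪ {P = P} {Q} Pj Qk = atMost λ xs xs! Pxs →
  let ys , zs , ys! , zs! , Pys , Qzs , len , _ = split xs xs! Pxs
  in ≤-trans (≤-reflexive len) (+-mono-≤ (bound Pj ys ys! Pys) (bound Qk zs zs! Qzs))
  where
  split : ∀ xs → Unique xs → All (P ∪ Q) xs →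
          ∃[ ys ] ∃[ zs ] (Unique ys × Unique zs × All P ys × All Q zs ×
            length xs ≡ length ys + length zs ×
            (∀ {x} → All (x ≢_) xs → All (x ≢_) ys × All (x ≢_) zs))
  split []       _            _ = [] , [] , [] , [] , [] , [] , refl , λ _ → [] , []
  split (x ∷ xs) (x∉xs ∷ xs!) (PQx ∷ PQxs)
    with ys , zs , ys! , zs! , Pys , Qzs , len , fresh ← split xs xs! PQxs
    with PQx
  ... | inj₁ Px = x ∷ ys , zs , proj₁ (fresh x∉xs) ∷ ys! , zs! , Px ∷ Pys , Qzs , cong suc len
                , λ { (≢x ∷ ≢xs) → ≢x ∷ proj₁ (fresh ≢xs) , proj₂ (fresh ≢xs) }
  ... | inj₂ Qx = ys , x ∷ zs , ys! , proj₂ (fresh x∉xs) ∷ zs! , Pys , Qx ∷ Qzs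
                , trans (cong suc len) (sym (+-suc (length ys) (length zs)))
                , λ { (≢x ∷ ≢xs) → proj₁ (fresh ≢xs) , ≢x ∷ proj₂ (fresh ≢xs) }

atMost-⋃ : ∀ {d k} {P : Fin d → Pred A 0ℓ} → (∀ i → AtMost (P i) k) →
           AtMost (λ x → ∃[ i ] P i x) (d * k)
atMost-⋃ {d = zero}  Pk = atMost-∅ λ { _ (() , _) }
atMost-⋃ {d = suc d} {P = P} Pk =
  atMost-⊆ (λ { (zero , Px) → inj₁ Px ; (suc i , Px) → inj₂ (i , Px) })
           (atMost-∪ (Pk zero) (atMost-⋃ {P = P ∘ suc} (Pk ∘ suc)))

atMost-∈ : (ys : List A) → AtMost (_∈ₗ ys) (length ys)
atMost-∈ []       = atMost-∅ λ _ ()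
atMost-∈ (y ∷ ys) =
  atMost-⊆ (λ { (here x≡y) → inj₁ x≡y ; (there x∈ys) → inj₂ x∈ys })
           (atMost-∪ {P = _≡ y} (atMost-1 λ { refl refl → refl }) (atMost-∈ ys))

-- The binomial coefficient `k` over 2.
triangular : ℕ → ℕ
triangular zero    = 0
triangular (suc k) = k + triangular k

-- Asymmetry admits at most one orientation of each unordered pair. The induction splits off a
-- member `a` of `T`: a pair containing `a` is determined by its other member, and the remaining
-- pairs avoid `a`.
atMost-asymmetric : ∀ {k} {T : Pred A 0ℓ} (_≺_ : Rel A 0ℓ) → DecidableEquality A →
  (∀ {x y} → x ≺ y → ¬ y ≺ x) → AtMost T k →
  AtMost {A = A × A} (λ (x , y) → T x × T y × x ≺ y) (triangular k)
atMost-asymmetric {k = zero} {T} _≺_ _≟_ asym T0 =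
  atMost-∅ λ (x , _) (Tx , _) → contradiction (bound T0 (x ∷ []) ([] ∷ []) (Tx ∷ [])) λ ()
atMost-asymmetric {A = A} {k = suc k} {T} _≺_ _≟_ asym Tk =
  atMost-inhabited λ (a , _) (Ta , _) → through a Ta
  where
  through : ∀ a → T a → AtMost {A = A × A} (λ (x , y) → T x × T y × x ≺ y) (triangular (suc k))
  through a Ta = atMost-⊆ split (atMost-∪ with-a without-a)
    where
    T─a : Pred A 0ℓ
    T─a x = T x × a ≢ x
    T─a-k : AtMost T─a k
    T─a-k = atMost-remove a Tk λ y (Ty , a≢y) → Ta , Ty , a≢y
    WithA : Pred (A × A) 0ℓ
    WithA (x , y) = x ≺ y × (x ≡ a × T─a y ⊎ T─a x × y ≡ a)
    WithoutA : Pred (A × A) 0ℓ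
    WithoutA (x , y) = T─a x × T─a y × x ≺ y
    with-a : AtMost WithA k
    with-a = atMost-image {P = WithA} {Q = T─a}
      (λ (x , y) z → x ≡ a × y ≡ z ⊎ x ≡ z × y ≡ a)
      (λ { (x , y) (_ , inj₁ (x≡a , T─ay)) → y , T─ay , inj₁ (x≡a , refl)
         ; (x , y) (_ , inj₂ (T─ax , y≡a)) → x , T─ax , inj₂ (refl , y≡a) })
      (λ { _ _ (inj₁ (refl , refl)) (inj₁ (refl , refl)) → refl
         ; (x≺y , _) (y≺x , _) (inj₁ (refl , refl)) (inj₂ (refl , refl)) → contradiction y≺x (asym x≺y)
         ; (x≺y , _) (y≺x , _) (inj₂ (refl , refl)) (inj₁ (refl , refl)) → contradiction y≺x (asym x≺y)
         ; _ _ (inj₂ (refl , refl)) (inj₂ (refl , refl)) → refl })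
      T─a-k
    without-a : AtMost WithoutA (triangular k)
    without-a = atMost-asymmetric _≺_ _≟_ asym T─a-k
    split : ∀ {z} → T (proj₁ z) × T (proj₂ z) × proj₁ z ≺ proj₂ z → (WithA ∪ WithoutA) z
    split {x , y} (Tx , Ty , x≺y) with a ≟ x | a ≟ y
    ... | yes refl | yes refl = contradiction x≺y (asym x≺y)
    ... | yes refl | no a≢y   = inj₁ (x≺y , inj₁ (refl , Ty , a≢y))
    ... | no a≢x   | yes refl = inj₁ (x≺y , inj₂ ((Tx , a≢x) , refl))
    ... | no a≢x   | no a≢y   = inj₂ ((Tx , a≢x) , (Ty , a≢y) , x≺y)

lookup-injective : {A : Set} {xs : List A} → Unique xs →
                   ∀ i j → lookup xs i ≡ lookup xs j → i ≡ j
lookup-injective (x∉xs ∷ xs!) zero    zero    _  = refl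
lookup-injective (x∉xs ∷ xs!) zero    (suc j) eq = contradiction eq (All.lookup x∉xs (∈-lookup j))
lookup-injective (x∉xs ∷ xs!) (suc i) zero    eq = contradiction (sym eq) (All.lookup x∉xs (∈-lookup i))
lookup-injective (x∉xs ∷ xs!) (suc i) (suc j) eq = cong suc (lookup-injective xs! i j eq)

-- Stars, neighbours and common neighbours in the line graph.

commonBound : ℕ → ℕ
commonBound k = suc (k ∸ 1 ∸ 1) ⊔ 4

module LineGraph {n : ℕ} (G : Graph n) where
  open Graph G

  Δ : ℕ
  Δ = maxDegree G

  Edge : Set
  Edge = Fin (∣E∣ G)

  H : Graph (∣E∣ G)
  H = lineGraph G

  open Graph H using () renaming (_~_ to _~ᴴ_; ~-sym to ~ᴴ-sym) public

  infix 4 _∈ᵉ_ _∈ᵉ?_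
  _∈ᵉ_ : Fin n → Edge → Set
  _∈ᵉ_ = IsEndOf G

  _∈ᵉ?_ : ∀ v e → Dec (v ∈ᵉ e)
  _∈ᵉ?_ = isEndOf? G

  source target : Edge → Fin n
  source e = proj₁ (lookup (edges G) e)
  target e = proj₂ (lookup (edges G) e)

  edges-unique : Unique (edges G)
  edges-unique = Unique.filter⁺ _ (Unique.cartesianProduct⁺ (Unique.allFin⁺ n) (Unique.allFin⁺ n))

  source<target : ∀ e → source e Fin.< target e
  source<target e = proj₁ (proj₂ (∈-filter⁻ (λ (i , j) → (i Fin.<? j) ×-dec (i ~? j))
    {xs = cartesianProduct (allFin n) (allFin n)} (∈-lookup e)))

  source~target : ∀ e → source e ~ target e
  source~target e = proj₂ (proj₂ (∈-filter⁻ (λ (i , j) → (i Fin.<? j) ×-dec (i ~? j))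
    {xs = cartesianProduct (allFin n) (allFin n)} (∈-lookup e)))

  source≢target : ∀ e → source e ≢ target e
  source≢target e = Fin.<⇒≢ (source<target e)

  otherEnd : ∀ {v e} → v ∈ᵉ e → ∃[ w ] (w ∈ᵉ e × w ≢ v × v ~ w)
  otherEnd {e = e} (inj₁ refl) = target e , inj₂ refl , ≢-sym (source≢target e) , source~target e
  otherEnd {e = e} (inj₂ refl) = source e , inj₁ refl , source≢target e , ~-sym (source~target e)

  third-end : ∀ {e u v w} → u ≢ v → u ∈ᵉ e → v ∈ᵉ e → w ∈ᵉ e → w ≡ u ⊎ w ≡ v
  third-end u≢v (inj₁ u) (inj₁ v) w        = contradiction (trans u (sym v)) u≢v
  third-end u≢v (inj₂ u) (inj₂ v) w        = contradiction (trans u (sym v)) u≢v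
  third-end u≢v (inj₁ u) (inj₂ v) (inj₁ w) = inj₁ (trans w (sym u))
  third-end u≢v (inj₁ u) (inj₂ v) (inj₂ w) = inj₂ (trans w (sym v))
  third-end u≢v (inj₂ u) (inj₁ v) (inj₁ w) = inj₂ (trans w (sym v))
  third-end u≢v (inj₂ u) (inj₁ v) (inj₂ w) = inj₁ (trans w (sym u))

  edge-from-ends : ∀ {e f u v} → u ≢ v → u ∈ᵉ e → v ∈ᵉ e → u ∈ᵉ f → v ∈ᵉ f → e ≡ f
  edge-from-ends {e} {f} u≢v ue ve uf vf = lookup-injective edges-unique e f (ends u≢v ue ve uf vf)
    where
    ends : ∀ {u v} → u ≢ v → u ∈ᵉ e → v ∈ᵉ e → u ∈ᵉ f → v ∈ᵉ f →
           lookup (edges G) e ≡ lookup (edges G) f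
    ends u≢v (inj₁ refl) (inj₁ refl) _ _ = contradiction refl u≢v
    ends u≢v (inj₂ refl) (inj₂ refl) _ _ = contradiction refl u≢v
    ends u≢v (inj₁ refl) (inj₂ refl) (inj₁ p) (inj₁ q) = contradiction (trans p (sym q)) u≢v
    ends u≢v (inj₁ refl) (inj₂ refl) (inj₂ p) (inj₂ q) = contradiction (trans p (sym q)) u≢v
    ends u≢v (inj₂ refl) (inj₁ refl) (inj₁ p) (inj₁ q) = contradiction (trans p (sym q)) u≢v
    ends u≢v (inj₂ refl) (inj₁ refl) (inj₂ p) (inj₂ q) = contradiction (trans p (sym q)) u≢v
    ends u≢v (inj₁ refl) (inj₂ refl) (inj₁ p) (inj₂ q) = cong₂ _,_ p q
    ends u≢v (inj₂ refl) (inj₁ refl) (inj₂ p) (inj₁ q) = cong₂ _,_ q p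
    -- A crossed matching of the ends would reverse the order of source and target, which every
    -- listed pair obeys.
    ends u≢v (inj₁ refl) (inj₂ refl) (inj₂ p) (inj₁ q) =
      ⊥-elim (Fin.<-asym (source<target f) (subst (Fin._< source f) p (subst (source e Fin.<_) q (source<target e))))
    ends u≢v (inj₂ refl) (inj₁ refl) (inj₁ p) (inj₂ q) =
      ⊥-elim (Fin.<-asym (source<target f) (subst (Fin._< source f) q (subst (source e Fin.<_) p (source<target e))))

  degree≤Δ : ∀ v → degree G v ≤ Δ
  degree≤Δ v = All.lookup (xs≤max 0 (map (degree G) (allFin n))) (∈-map⁺ (degree G) (∈-allFin v))

  -- An edge at `v` is determined by its other end, which is one of the neighbours counted by the
  -- degree.
  atMost-star : ∀ v → AtMost (v ∈ᵉ_) Δ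
  atMost-star v = atMost-≤ (degree≤Δ v)
    (atMost-image (λ e w → w ∈ᵉ e × w ≢ v)
      (λ e v∈e → let w , w∈e , w≢v , v~w = otherEnd v∈e
                 in w , ∈-filter⁺ (v ~?_) (∈-allFin w) v~w , w∈e , w≢v)
      (λ v∈e v∈f (w∈e , w≢v) (w∈f , _) → edge-from-ends w≢v w∈e v∈e w∈f v∈f)
      (atMost-∈ (filter (v ~?_) (allFin n))))

  through-end : ∀ {e f} → e ~ᴴ f → source e ∈ᵉ f ⊎ target e ∈ᵉ f
  through-end (_ , _ , inj₁ refl , v∈f) = inj₁ v∈f
  through-end (_ , _ , inj₂ refl , v∈f) = inj₂ v∈f

  atMost-neighbours : ∀ e → AtMost (e ~ᴴ_) (2 * (Δ ∸ 1))
  atMost-neighbours e = atMost-≤ (≤-reflexive (cong (Δ ∸ 1 +_) (sym (ℕ.+-identityʳ (Δ ∸ 1)))))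
    (atMost-⊆ split (atMost-∪ (star-minus (inj₁ refl)) (star-minus (inj₂ refl))))
    where
    star-minus : ∀ {v} → v ∈ᵉ e → AtMost (λ f → e ≢ f × v ∈ᵉ f) (Δ ∸ 1)
    star-minus {v} v∈e = atMost-remove e (atMost-star v) λ f (e≢f , v∈f) → v∈e , v∈f , e≢f
    split : ∀ {f} → e ~ᴴ f → (e ≢ f × source e ∈ᵉ f) ⊎ (e ≢ f × target e ∈ᵉ f)
    split adj with through-end adj
    ... | inj₁ s∈f = inj₁ (proj₁ adj , s∈f)
    ... | inj₂ t∈f = inj₂ (proj₁ adj , t∈f)

  avoiding : ∀ {a e f} → e ~ᴴ f → ¬ a ∈ᵉ f → ∃[ c ] (c ∈ᵉ e × c ∈ᵉ f × c ≢ a)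
  avoiding (_ , c , c∈e , c∈f) a∉f = c , c∈e , c∈f , λ { refl → a∉f c∈f }

  same-end : ∀ {a c d e} → a ∈ᵉ e → c ∈ᵉ e → d ∈ᵉ e → c ≢ a → d ≢ a → c ≡ d
  same-end a∈e c∈e d∈e c≢a d≢a with third-end c≢a c∈e a∈e d∈e
  ... | inj₁ d≡c = sym d≡c
  ... | inj₂ d≡a = contradiction d≡a d≢a

  -- An edge that meets both `e` and `e′` away from their common end `a` joins their two other ends:
  -- it closes the triangle.
  transversal-unique : ∀ {a e e′ f g} → e ≢ e′ → a ∈ᵉ e → a ∈ᵉ e′ →
    e ~ᴴ f → e′ ~ᴴ f → e ~ᴴ g → e′ ~ᴴ g → ¬ a ∈ᵉ f → ¬ a ∈ᵉ g → f ≡ g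
  transversal-unique e≢e′ a∈e a∈e′ ef e′f eg e′g a∉f a∉g
    with c , c∈e , c∈f , c≢a ← avoiding ef a∉f
       | d , d∈e′ , d∈f , d≢a ← avoiding e′f a∉f
       | c′ , c′∈e , c′∈g , c′≢a ← avoiding eg a∉g
       | d′ , d′∈e′ , d′∈g , d′≢a ← avoiding e′g a∉g
    with refl ← same-end a∈e c∈e c′∈e c≢a c′≢a
       | refl ← same-end a∈e′ d∈e′ d′∈e′ d≢a d′≢a
    = edge-from-ends (λ { refl → e≢e′ (edge-from-ends c≢a c∈e a∈e d∈e′ a∈e′) }) c∈f d∈f c′∈g d′∈g

  -- If `e` and `e′` share an end, their common neighbours are at most Δ - 2 further edges of that
  -- star and one edge closing a triangle. If they are disjoint, a common neighbour joins an end of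
  -- one to an end of the other, in one of four ways. These are the two arguments of the maximum in
  -- `commonBound`.
  atMost-common-neighbours : ∀ {e e′} → e ≢ e′ → AtMost (λ f → e ~ᴴ f × e′ ~ᴴ f) (commonBound Δ)
  atMost-common-neighbours {e} {e′} e≢e′ with Fin.any? (λ v → v ∈ᵉ? e ×-dec v ∈ᵉ? e′)
  ... | yes (a , a∈e , a∈e′) = atMost-≤ (m≤m⊔n (suc (Δ ∸ 1 ∸ 1)) 4)
        (atMost-≤ (≤-reflexive (+-comm (Δ ∸ 1 ∸ 1) 1)) (atMost-⊆ split (atMost-∪ in-star outside)))
    where
    InStar Outside : Pred Edge 0ℓ
    InStar f = a ∈ᵉ f × e ~ᴴ f × e′ ~ᴴ f
    Outside f = ¬ a ∈ᵉ f × e ~ᴴ f × e′ ~ᴴ f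
    in-star : AtMost InStar (Δ ∸ 1 ∸ 1)
    in-star = atMost-remove e′
      (atMost-remove {Q = λ f → a ∈ᵉ f × e ≢ f} e (atMost-star a) λ f (a∈f , e≢f) → a∈e , a∈f , e≢f)
      λ f (a∈f , (e≢f , _) , (e′≢f , _)) → (a∈e′ , e≢e′) , (a∈f , e≢f) , e′≢f
    outside : AtMost Outside 1
    outside = atMost-1 λ (a∉f , ef , e′f) (a∉g , eg , e′g) →
      transversal-unique e≢e′ a∈e a∈e′ ef e′f eg e′g a∉f a∉g
    split : ∀ {f} → e ~ᴴ f × e′ ~ᴴ f → (InStar ∪ Outside) f
    split {f} adj with a ∈ᵉ? f
    ... | yes a∈f = inj₁ (a∈f , adj)
    ... | no  a∉f = inj₂ (a∉f , adj)
  ... | no disjoint = atMost-≤ (m≤n⊔m (suc (Δ ∸ 1 ∸ 1)) 4)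
        (atMost-image (λ f (v , w) → v ∈ᵉ e × w ∈ᵉ e′ × v ∈ᵉ f × w ∈ᵉ f) total
          (λ _ _ (v∈e , w∈e′ , v∈f , w∈f) (_ , _ , v∈g , w∈g) →
            edge-from-ends (λ { refl → disjoint (_ , v∈e , w∈e′) }) v∈f w∈f v∈g w∈g)
          (atMost-∈ corners))
    where
    corners : List (Fin n × Fin n)
    corners = (source e , source e′) ∷ (source e , target e′) ∷ (target e , source e′) ∷ (target e , target e′) ∷ []
    total : ∀ f → e ~ᴴ f × e′ ~ᴴ f →
            ∃[ vw ] (vw ∈ₗ corners × proj₁ vw ∈ᵉ e × proj₂ vw ∈ᵉ e′ × proj₁ vw ∈ᵉ f × proj₂ vw ∈ᵉ f)
    total f (ef , e′f) with through-end ef | through-end e′f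
    ... | inj₁ p | inj₁ q = _ , here refl , inj₁ refl , inj₁ refl , p , q
    ... | inj₁ p | inj₂ q = _ , there (here refl) , inj₁ refl , inj₂ refl , p , q
    ... | inj₂ p | inj₁ q = _ , there (there (here refl)) , inj₂ refl , inj₁ refl , p , q
    ... | inj₂ p | inj₂ q = _ , there (there (there (here refl))) , inj₂ refl , inj₂ refl , p , q

-- Interval orders.

record IsIntervalOrder {A : Set} (_≺_ : Rel A 0ℓ) : Set where
  field
    irrefl  : ∀ x → ¬ x ≺ x
    -- The absence of 2+2: whichever of `w` and `y` ends first precedes both `x` and `z`.
    -- Transitivity is the case `x = y`.
    ferrers : ∀ w x y z → w ≺ x → y ≺ z → w ≺ z ⊎ y ≺ x

  asym : ∀ {x y} → x ≺ y → ¬ y ≺ x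
  asym {x} {y} x≺y y≺x with ferrers x y y x x≺y y≺x
  ... | inj₁ x≺x = irrefl x x≺x
  ... | inj₂ y≺y = irrefl y y≺y

flip-isIntervalOrder : {A : Set} {_≺_ : Rel A 0ℓ} → IsIntervalOrder _≺_ → IsIntervalOrder (flip _≺_)
flip-isIntervalOrder io = record
  { irrefl  = irrefl
  ; ferrers = λ w x y z x≺w z≺y → swap (ferrers x w z y x≺w z≺y)
  } where open IsIntervalOrder io

-- In terms of intervals, y ≼ z says that y ends no later than z.
module Domination {m : ℕ} (_≺_ : Rel (Fin m) 0ℓ) (_≺?_ : Decidable _≺_) (io : IsIntervalOrder _≺_) where
  open IsIntervalOrder io

  _≼_ : Rel (Fin m) 0ℓ
  y ≼ z = ∀ x → z ≺ x → y ≺ x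

  -- Given `x` with `z ≺ x` but not `y ≺ x`, the Ferrers condition puts everything after `y` also
  -- after `z`.
  ≼-total : ∀ y z → y ≼ z ⊎ z ≼ y
  ≼-total y z with Fin.any? (λ x → (z ≺? x) ×-dec ¬? (y ≺? x))
  ... | yes (x , z≺x , y⊀x) = inj₂ λ x′ y≺x′ → case ferrers z x y x′ z≺x y≺x′ of λ
        { (inj₁ z≺x′) → z≺x′
        ; (inj₂ y≺x)  → contradiction y≺x y⊀x }
  ... | no none = inj₁ λ x z≺x → decidable-stable (y ≺? x) λ y⊀x → none (x , z≺x , y⊀x)

  leading : ∀ x xs → ∃[ y ] (y ∈ₗ x ∷ xs × All (y ≼_) (x ∷ xs))
  leading x []        = x , here refl , (λ _ z≺ → z≺) ∷ []
  leading x (x′ ∷ xs) with y , y∈ , y≼ ← leading x′ xs with ≼-total x y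
  ... | inj₁ x≼y = x , here refl , (λ _ x≺ → x≺) ∷ All.map (λ y≼z u z≺u → x≼y u (y≼z u z≺u)) y≼
  ... | inj₂ y≼x = y , there y∈ , y≼x ∷ y≼

  two-leading : ∀ {e f} → e ≢ f →
    ∃[ e₁ ] ∃[ e₂ ] (e₁ ≢ e₂ × (∀ z → e₁ ≼ z) × (∀ z → e₁ ≢ z → e₂ ≼ z))
  two-leading {e} {f} e≢f =
    let e₁ , _ , e₁≼ = leading e (allFin m)
        -- One of the two given elements differs from `e₁`; it serves as the head that `leading`
        -- requires.
        x , e₁≢x = another e₁
        e₂ , e₂∈ , e₂≼ = leading x (filter (λ z → ¬? (e₁ Fin.≟ z)) (allFin m))
    in e₁ , e₂ , distinct e₁≢x e₂∈
    , (λ z → All.lookup e₁≼ (there (∈-allFin z)))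
    , λ z e₁≢z → All.lookup e₂≼ (there (∈-filter⁺ (λ z → ¬? (e₁ Fin.≟ z)) (∈-allFin z) e₁≢z))
    where
    another : ∀ e₁ → ∃[ x ] e₁ ≢ x
    another e₁ with e₁ Fin.≟ e
    ... | yes refl = f , e≢f
    ... | no e₁≢e  = e , e₁≢e
    distinct : ∀ {e₁ e₂ x} → e₁ ≢ x → e₂ ∈ₗ x ∷ filter (λ z → ¬? (e₁ Fin.≟ z)) (allFin m) → e₁ ≢ e₂
    distinct e₁≢x (here refl) = e₁≢x
    distinct {e₁} e₁≢x (there e₂∈) = proj₂ (∈-filter⁻ (λ z → ¬? (e₁ Fin.≟ z)) {xs = allFin m} e₂∈)

-- Comparable pairs of one interval order within the line graph.

pairBound : ℕ → ℕ
pairBound k = 2 * (k ∸ 1) + ((2 * (k ∸ 1) ∸ 1) + ((commonBound k ∸ 1) +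
  ((commonBound k ∸ 1 ∸ 1) + triangular (k ∸ 1 ∸ 1 ∸ 1 ∸ 1))))

module _ {n : ℕ} (G : Graph n) where
  open LineGraph G

  Injective : (Fin 3 → Edge) → Set
  Injective E = ∀ i j → E i ≡ E j → i ≡ j

  third : ∀ (i j : Fin 3) → ∃[ k ] (k ≢ i × k ≢ j)
  third = toWitness {a? = Fin.all? λ i → Fin.all? λ j → Fin.any? λ k → ¬? (k Fin.≟ i) ×-dec ¬? (k Fin.≟ j)} _

  -- If `E i` missed `a`, it would be the edge closing the triangle on `F j` and `F j′`, so the
  -- other two edges of `E` would pass through `a`. The third edge `F k` meets `E i` in some `w`. If
  -- `F k` contains `a`, it coincides with `F j` or `F j′`; if not, it joins the far ends of the
  -- other two edges of `E`, so one of these coincides with an edge of `F`, although adjacent edges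
  -- are distinct.
  all-through : ∀ {E F} → Injective E → Injective F → (∀ i j → E i ~ᴴ F j) →
                ∀ {a j j′} → j ≢ j′ → a ∈ᵉ F j → a ∈ᵉ F j′ → ∀ i → a ∈ᵉ E i
  all-through {E} {F} E-inj F-inj cross {a} {j} {j′} j≢j′ a∈Fj a∈Fj′ i =
    decidable-stable (a ∈ᵉ? E i) λ a∉Ei →
      let c , c∈Fj , c∈Ei , c≢a = avoiding (~ᴴ-sym (cross i j)) a∉Ei
          d , d∈Fj′ , d∈Ei , d≢a = avoiding (~ᴴ-sym (cross i j′)) a∉Ei
          c≢d : c ≢ d
          c≢d = λ c≡d → j≢j′ (F-inj j j′
            (edge-from-ends c≢a c∈Fj a∈Fj (subst (_∈ᵉ F j′) (sym c≡d) d∈Fj′) a∈Fj′))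
          k , k≢j , k≢j′ = third j j′
          _ , w , w∈Ei , w∈Fk = cross i k
          w≢a : w ≢ a
          w≢a = λ w≡a → a∉Ei (subst (_∈ᵉ E i) w≡a w∈Ei)
          i₁ , i₁≢i , _ = third i i
          i₂ , i₂≢i , i₂≢i₁ = third i i₁
          a∈E : ∀ i′ → i′ ≢ i → a ∈ᵉ E i′
          a∈E = λ i′ i′≢i → decidable-stable (a ∈ᵉ? E i′) λ a∉Ei′ →
            i′≢i (E-inj i′ i (transversal-unique (λ Fj≡Fj′ → j≢j′ (F-inj j j′ Fj≡Fj′)) a∈Fj a∈Fj′
              (~ᴴ-sym (cross i′ j)) (~ᴴ-sym (cross i′ j′)) (~ᴴ-sym (cross i j)) (~ᴴ-sym (cross i j′)) a∉Ei′ a∉Ei))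
          -- w lies on E i = {c , d}, so {a , w} is F j or F j′; but it is also F k, E i₁ or E i₂.
          aw-is-F : ∃[ l ] (l ≢ k × w ∈ᵉ F l × a ∈ᵉ F l)
          aw-is-F = case third-end c≢d c∈Ei d∈Ei w∈Ei of λ
            { (inj₁ w≡c) → j , ≢-sym k≢j , subst (_∈ᵉ F j) (sym w≡c) c∈Fj , a∈Fj
            ; (inj₂ w≡d) → j′ , ≢-sym k≢j′ , subst (_∈ᵉ F j′) (sym w≡d) d∈Fj′ , a∈Fj′ }
          l , l≢k , w∈Fl , a∈Fl = aw-is-F
          w∉E : ∀ i′ → i′ ≢ i → ¬ w ∈ᵉ E i′
          w∉E = λ i′ i′≢i w∈Ei′ → proj₁ (cross i′ l) (edge-from-ends w≢a w∈Ei′ (a∈E i′ i′≢i) w∈Fl a∈Fl)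
      in case a ∈ᵉ? F k of λ
        { (yes a∈Fk) → l≢k (F-inj l k (edge-from-ends w≢a w∈Fl a∈Fl w∈Fk a∈Fk))
        ; (no a∉Fk) →
          let x , x∈E₁ , x∈Fk , x≢a = avoiding (cross i₁ k) a∉Fk
              y , y∈E₂ , y∈Fk , y≢a = avoiding (cross i₂ k) a∉Fk
              x≢y : x ≢ y
              x≢y = λ x≡y → i₂≢i₁ (E-inj i₂ i₁ (edge-from-ends y≢a
                y∈E₂ (a∈E i₂ i₂≢i) (subst (_∈ᵉ E i₁) x≡y x∈E₁) (a∈E i₁ i₁≢i)))
          in case third-end x≢y x∈Fk y∈Fk w∈Fk of λ
            { (inj₁ w≡x) → w∉E i₁ i₁≢i (subst (_∈ᵉ E i₁) (sym w≡x) x∈E₁)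
            ; (inj₂ w≡y) → w∉E i₂ i₂≢i (subst (_∈ᵉ E i₂) (sym w≡y) y∈E₂) } }

  -- By pigeonhole two of the three edges of `F` contain the same end of `E zero`. Hence all of `E`
  -- passes through that end, and then so does all of `F`.
  star-centre : ∀ {E F} → Injective E → Injective F → (∀ i j → E i ~ᴴ F j) →
                ∃[ a ] ((∀ i → a ∈ᵉ E i) × (∀ j → a ∈ᵉ F j))
  star-centre {E} {F} E-inj F-inj cross =
    let a , j , j′ , j≢j′ , a∈Fj , a∈Fj′ = two-meet
        a∈E = all-through E-inj F-inj cross j≢j′ a∈Fj a∈Fj′
    in a , a∈E ,
       all-through F-inj E-inj (λ j i → ~ᴴ-sym (cross i j)) {j = zero} {suc zero} (λ ()) (a∈E zero) (a∈E (suc zero))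
    where
    two-meet : ∃[ a ] ∃[ j ] ∃[ j′ ] (j ≢ j′ × a ∈ᵉ F j × a ∈ᵉ F j′)
    two-meet with through-end (cross zero zero) | through-end (cross zero (suc zero))
                | through-end (cross zero (suc (suc zero)))
    ... | inj₁ p | inj₁ q | _      = _ , zero , suc zero , (λ ()) , p , q
    ... | inj₂ p | inj₂ q | _      = _ , zero , suc zero , (λ ()) , p , q
    ... | inj₁ p | inj₂ _ | inj₁ r = _ , zero , suc (suc zero) , (λ ()) , p , r
    ... | inj₁ _ | inj₂ q | inj₂ r = _ , suc zero , suc (suc zero) , (λ ()) , q , r
    ... | inj₂ p | inj₁ _ | inj₂ r = _ , zero , suc (suc zero) , (λ ()) , p , r
    ... | inj₂ _ | inj₁ q | inj₁ r = _ , suc zero , suc (suc zero) , (λ ()) , q , r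

  module _ (_≺_ : Rel Edge 0ℓ) (_≺?_ : Decidable _≺_) (io : IsIntervalOrder _≺_)
           (≺⇒~ : ∀ {e f} → e ≺ f → e ~ᴴ f) where
    open IsIntervalOrder io
    module Left = Domination _≺_ _≺?_ io
    module Right = Domination (flip _≺_) (flip _≺?_) (flip-isIntervalOrder io)

    atMost-comparable : AtMost {A = Edge × Edge} (λ (e , f) → e ≺ f) (pairBound Δ)
    atMost-comparable = atMost-inhabited λ (e , f) e≺f →
      let e≢f = proj₁ (≺⇒~ e≺f)
          e₁ , e₂ , e₁≢e₂ , e₁≼ , e₂≼ = Left.two-leading e≢f
          f₁ , f₂ , f₁≢f₂ , f₁≼ , f₂≼ = Right.two-leading e≢f
      in peel e₁≢e₂ e₁≼ e₂≼ f₁≢f₂ f₁≼ f₂≼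
      where
      peel : ∀ {e₁ e₂ f₁ f₂} →
        e₁ ≢ e₂ → (∀ z → e₁ Left.≼ z) → (∀ z → e₁ ≢ z → e₂ Left.≼ z) →
        f₁ ≢ f₂ → (∀ z → f₁ Right.≼ z) → (∀ z → f₁ ≢ z → f₂ Right.≼ z) →
        AtMost {A = Edge × Edge} (λ (e , f) → e ≺ f) (pairBound Δ)
      peel {e₁} {e₂} {f₁} {f₂} e₁≢e₂ e₁≼ e₂≼ f₁≢f₂ f₁≼ f₂≼ =
        -- These are the summands of `pairBound` in order. Each later row or column omits the
        -- leading edges already treated on the other side: `e₁` from `column₁`, `f₁` from `row₂`,
        -- and both `e₁` and `e₂` from `column₂`.
        atMost-⊆ split (atMost-∪ row₁ (atMost-∪ column₁ (atMost-∪ row₂ (atMost-∪ column₂ rest))))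
        where
        Row₁ Column₁ Row₂ Column₂ Rest : Pred (Edge × Edge) 0ℓ
        Row₁ (e , f) = e ≡ e₁ × e₁ ≺ f
        Column₁ (e , f) = f ≡ f₁ × e ≺ f₁ × e₁ ≢ e
        Row₂ (e , f) = e ≡ e₂ × e₂ ≺ f × f₁ ≢ f
        Column₂ (e , f) = f ≡ f₂ × e ≺ f₂ × e₁ ≢ e × e₂ ≢ e
        Rest (e , f) = e ≺ f × e₁ ≢ e × e₂ ≢ e × f₁ ≢ f × f₂ ≢ f

        split : ∀ {z} → proj₁ z ≺ proj₂ z → (Row₁ ∪ (Column₁ ∪ (Row₂ ∪ (Column₂ ∪ Rest)))) z
        split {e , f} e≺f with e₁ Fin.≟ e | f₁ Fin.≟ f | e₂ Fin.≟ e | f₂ Fin.≟ f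
        ... | yes refl | _        | _        | _        = inj₁ (refl , e≺f)
        ... | no e₁≢e  | yes refl | _        | _        = inj₂ (inj₁ (refl , e≺f , e₁≢e))
        ... | no e₁≢e  | no f₁≢f  | yes refl | _        = inj₂ (inj₂ (inj₁ (refl , e≺f , f₁≢f)))
        ... | no e₁≢e  | no f₁≢f  | no e₂≢e  | yes refl = inj₂ (inj₂ (inj₂ (inj₁ (refl , e≺f , e₁≢e , e₂≢e))))
        ... | no e₁≢e  | no f₁≢f  | no e₂≢e  | no f₂≢f  = inj₂ (inj₂ (inj₂ (inj₂ (e≺f , e₁≢e , e₂≢e , f₁≢f , f₂≢f))))

        row₁ : AtMost Row₁ (2 * (Δ ∸ 1))
        row₁ = atMost-image (λ (e , f) g → f ≡ g)
          (λ { (e , f) (refl , e₁≺f) → f , ≺⇒~ e₁≺f , refl })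
          (λ { (refl , _) (refl , _) refl refl → refl })
          (atMost-neighbours e₁)

        column₁ : AtMost Column₁ (2 * (Δ ∸ 1) ∸ 1)
        column₁ = atMost-image (λ (e , f) g → e ≡ g)
          (λ { (e , f) (refl , e≺f₁ , e₁≢e) → e , (e≺f₁ , e₁≢e) , refl })
          (λ { (refl , _) (refl , _) refl refl → refl })
          -- As `e₁` ends first, any `e ≺ f₁` yields `e₁ ≺ f₁`, so `e₁` is one of the neighbours of
          -- `f₁` and can be discounted.
          (atMost-remove {Q = λ e → e ≺ f₁ × e₁ ≢ e} e₁ (atMost-neighbours f₁) λ e (e≺f₁ , e₁≢e) →
            ~ᴴ-sym (≺⇒~ (e₁≼ e f₁ e≺f₁)) , ~ᴴ-sym (≺⇒~ e≺f₁) , e₁≢e)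

        row₂ : AtMost Row₂ (commonBound Δ ∸ 1)
        row₂ = atMost-image (λ (e , f) g → f ≡ g)
          (λ { (e , f) (refl , e₂≺f , f₁≢f) → f , (e₂≺f , f₁≢f) , refl })
          (λ { (refl , _) (refl , _) refl refl → refl })
          (atMost-remove {Q = λ f → e₂ ≺ f × f₁ ≢ f} f₁ (atMost-common-neighbours e₁≢e₂) λ f (e₂≺f , f₁≢f) →
            common (f₁≼ f e₂ e₂≺f) , common e₂≺f , f₁≢f)
          where
          common : ∀ {f} → e₂ ≺ f → e₁ ~ᴴ f × e₂ ~ᴴ f
          common e₂≺f = ≺⇒~ (e₁≼ e₂ _ e₂≺f) , ≺⇒~ e₂≺f

        column₂ : AtMost Column₂ (commonBound Δ ∸ 1 ∸ 1)
        column₂ = atMost-image (λ (e , f) g → e ≡ g)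
          (λ { (e , f) (refl , e≺f₂ , ≢e) → e , (e≺f₂ , ≢e) , refl })
          (λ { (refl , _) (refl , _) refl refl → refl })
          (atMost-remove {Q = λ e → e ≺ f₂ × e₁ ≢ e × e₂ ≢ e} e₂
            (atMost-remove {Q = λ e → e ≺ f₂ × e₁ ≢ e} e₁ (atMost-common-neighbours f₁≢f₂)
              λ e (e≺f₂ , e₁≢e) → common (e₁≼ e f₂ e≺f₂) , common e≺f₂ , e₁≢e)
            λ e (e≺f₂ , e₁≢e , e₂≢e) → (e₂≼ e e₁≢e f₂ e≺f₂ , e₁≢e₂) , (e≺f₂ , e₁≢e) , e₂≢e)
          where
          common : ∀ {e} → e ≺ f₂ → f₁ ~ᴴ e × f₂ ~ᴴ e
          common e≺f₂ = ~ᴴ-sym (≺⇒~ (f₁≼ f₂ _ e≺f₂)) , ~ᴴ-sym (≺⇒~ e≺f₂)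

        below-f : ∀ {e f} → f₁ ≢ f → e ≺ f → All (e ≺_) (f₁ ∷ f₂ ∷ f ∷ [])
        below-f {e} {f} f₁≢f e≺f = f₁≼ f e e≺f ∷ f₂≼ f f₁≢f e e≺f ∷ e≺f ∷ []

        all-below : ∀ {e f} → Rest (e , f) → All (λ x → All (x ≺_) (f₁ ∷ f₂ ∷ f ∷ [])) (e₁ ∷ e₂ ∷ e ∷ [])
        all-below {e} {f} (e≺f , e₁≢e , _ , f₁≢f , _) =
          below-f f₁≢f (e₁≼ e f e≺f) ∷ below-f f₁≢f (e₂≼ e e₁≢e f e≺f) ∷ below-f f₁≢f e≺f ∷ []

        centre : ∀ {e f} → Rest (e , f) →
                 ∃[ a ] (All (a ∈ᵉ_) (e₁ ∷ e₂ ∷ e ∷ []) × All (a ∈ᵉ_) (f₁ ∷ f₂ ∷ f ∷ []))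
        centre {e} {f} r@(_ , e₁≢e , e₂≢e , f₁≢f , f₂≢f) =
          let a , a∈E , a∈F = star-centre
                (lookup-injective ((e₁≢e₂ ∷ e₁≢e ∷ []) ∷ (e₂≢e ∷ []) ∷ [] ∷ []))
                (lookup-injective ((f₁≢f₂ ∷ f₁≢f ∷ []) ∷ (f₂≢f ∷ []) ∷ [] ∷ []))
                (λ i j → ≺⇒~ (All.lookup (All.lookup (all-below r) (∈-lookup i)) (∈-lookup j)))
          in a , a∈E zero ∷ a∈E (suc zero) ∷ a∈E (suc (suc zero)) ∷ []
               , a∈F zero ∷ a∈F (suc zero) ∷ a∈F (suc (suc zero)) ∷ []

        rest : AtMost Rest (triangular (Δ ∸ 1 ∸ 1 ∸ 1 ∸ 1))
        rest = atMost-inhabited λ _ r → from-centre r (centre r)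
          where
          from-centre : ∀ {e f} → Rest (e , f) →
            ∃[ a ] (All (a ∈ᵉ_) (e₁ ∷ e₂ ∷ e ∷ []) × All (a ∈ᵉ_) (f₁ ∷ f₂ ∷ f ∷ [])) →
            AtMost Rest (triangular (Δ ∸ 1 ∸ 1 ∸ 1 ∸ 1))
          from-centre r (a , a∈e₁ ∷ a∈e₂ ∷ _ , a∈f₁ ∷ a∈f₂ ∷ _)
            with (e₁f₁ ∷ e₁f₂ ∷ _) ∷ (e₂f₁ ∷ e₂f₂ ∷ _) ∷ _ ← all-below r
            = atMost-⊆ inside (atMost-asymmetric _≺_ Fin._≟_ asym four-removed)
            where
            Star₁ Star₂ Star₃ Star₄ : Pred Edge 0ℓ
            Star₁ x = a ∈ᵉ x × e₁ ≢ x
            Star₂ x = Star₁ x × e₂ ≢ x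
            Star₃ x = Star₂ x × f₁ ≢ x
            Star₄ x = Star₃ x × f₂ ≢ x
            ≺⇒≢ : ∀ {x y} → x ≺ y → x ≢ y
            ≺⇒≢ x≺y refl = irrefl _ x≺y
            four-removed : AtMost Star₄ (Δ ∸ 1 ∸ 1 ∸ 1 ∸ 1)
            four-removed =
              atMost-remove f₂
                (atMost-remove {Q = Star₃} f₁
                  (atMost-remove {Q = Star₂} e₂
                    (atMost-remove {Q = Star₁} e₁ (atMost-star a)
                      λ _ (a∈x , ≢x) → a∈e₁ , a∈x , ≢x)
                    λ _ (Sx , ≢x) → (a∈e₂ , e₁≢e₂) , Sx , ≢x)
                  λ _ (Sx , ≢x) → ((a∈f₁ , ≺⇒≢ e₁f₁) , ≺⇒≢ e₂f₁) , Sx , ≢x)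
                λ _ (Sx , ≢x) → (((a∈f₂ , ≺⇒≢ e₁f₂) , ≺⇒≢ e₂f₂) , f₁≢f₂) , Sx , ≢x
            inside : ∀ {z} → Rest z → Star₄ (proj₁ z) × Star₄ (proj₂ z) × proj₁ z ≺ proj₂ z
            inside {e , f} r@(e≺f , e₁≢e , e₂≢e , f₁≢f , f₂≢f) = place (centre r) (all-below r)
              where
              place : ∃[ a′ ] (All (a′ ∈ᵉ_) (e₁ ∷ e₂ ∷ e ∷ []) × All (a′ ∈ᵉ_) (f₁ ∷ f₂ ∷ f ∷ [])) →
                      All (λ x → All (x ≺_) (f₁ ∷ f₂ ∷ f ∷ [])) (e₁ ∷ e₂ ∷ e ∷ []) →
                      Star₄ e × Star₄ f × e ≺ f
              place (a′ , a′∈e₁ ∷ a′∈e₂ ∷ a′∈e ∷ [] , _ ∷ _ ∷ a′∈f ∷ [])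
                    ((_ ∷ _ ∷ e₁f ∷ _) ∷ (_ ∷ _ ∷ e₂f ∷ _) ∷ (ef₁ ∷ ef₂ ∷ _) ∷ []) =
                  ((((subst (_∈ᵉ e) a′≡a a′∈e , e₁≢e) , e₂≢e) , ≢-sym (≺⇒≢ ef₁)) , ≢-sym (≺⇒≢ ef₂))
                , ((((subst (_∈ᵉ f) a′≡a a′∈f , ≺⇒≢ e₁f) , ≺⇒≢ e₂f) , f₁≢f) , f₂≢f)
                , e≺f
                where
                -- All pairs in `Rest` have the same centre, since the distinct edges `e₁` and `e₂`
                -- share only one end.
                a′≡a : a′ ≡ a
                a′≡a = decidable-stable (a′ Fin.≟ a) λ a′≢a →
                  e₁≢e₂ (edge-from-ends a′≢a a′∈e₁ a∈e₁ a′∈e₂ a∈e₂)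

-- Comparison of Dedekind reals and the embedding of the naturals.

open Equivalence using (to) renaming (from to ⇔-from)

L-down : ∀ (x : ℝ) {p q} → p ℚ.< q → ℝ.L x q → ℝ.L x p
L-down x p<q q∈L = ⇔-from (ℝ.L-rounded x _) (_ , p<q , q∈L)

-- Locatedness of `x` at a gap `p < q` inside the lower cut of `y` either puts `p` below `x` or
-- bounds `x` by `q`, and the latter would give `x ≤ᴿ y`.
≰ᴿ⇒≥ᴿ : ∀ x y → ¬ x ≤ᴿ y → y ≤ᴿ x
≰ᴿ⇒≥ᴿ x y x≰y {p} p∈Ly with q , p<q , q∈Ly ← to (ℝ.L-rounded y p) p∈Ly with ℝ.located x p q p<q
... | inj₁ p∈Lx = p∈Lx
... | inj₂ q∈Ux = ⊥-elim (x≰y x≤y)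
  where
  x≤y : x ≤ᴿ y
  x≤y {r} r∈Lx with ℚ.<-cmp r q
  ... | tri< r<q _ _ = L-down y r<q q∈Ly
  ... | tri≈ _ refl _ = q∈Ly
  ... | tri> _ _ q<r = contradiction (L-down x q<r r∈Lx , q∈Ux) (ℝ.disjoint x q)

fromℚ : ℚ → ℝ
fromℚ p = record
  { L           = ℚ._< p
  ; U           = p ℚ.<_
  ; L-inhabited = p ℚ.- 1ℚ , subst (p ℚ.- 1ℚ ℚ.<_) (ℚ.+-identityʳ p) (ℚ.+-monoʳ-< p (ℚ.negative⁻¹ (ℚ.- 1ℚ)))
  ; U-inhabited = p ℚ.+ 1ℚ , subst (ℚ._< p ℚ.+ 1ℚ) (ℚ.+-identityʳ p) (ℚ.+-monoʳ-< p (ℚ.positive⁻¹ 1ℚ))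
  ; L-rounded   = λ q → mk⇔ (λ q<p → let r , q<r , r<p = ℚ.<-dense q<p in r , q<r , r<p)
                            (λ (r , q<r , r<p) → ℚ.<-trans q<r r<p)
  ; U-rounded   = λ q → mk⇔ (λ p<q → let r , p<r , r<q = ℚ.<-dense p<q in r , r<q , p<r)
                            (λ (r , r<q , p<r) → ℚ.<-trans p<r r<q)
  ; disjoint    = λ q (q<p , p<q) → ℚ.<-asym q<p p<q
  ; located     = located
  }
  where
  located : ∀ q r → q ℚ.< r → q ℚ.< p ⊎ p ℚ.< r
  located q r q<r with ℚ.<-cmp q p
  ... | tri< q<p _ _ = inj₁ q<p
  ... | tri≈ _ refl _ = inj₂ q<r
  ... | tri> _ _ p<q = inj₂ (ℚ.<-trans p<q q<r)

-- Built with `mkℚ`, whose second argument is the denominator minus one, so that comparisons unfold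
-- to integers multiplied by 1.
fromℕ : ℕ → ℝ
fromℕ n = fromℚ (mkℚ (ℤ.+ n) 0 (Coprimality.sym (Coprimality.1-coprimeTo n)))

fromℕ-mono : ∀ {m n} → m ≤ n → fromℕ m ≤ᴿ fromℕ n
fromℕ-mono m≤n p<m = ℚ.<-≤-trans p<m (ℚ.*≤* (ℤ.*-monoʳ-≤-nonNeg (ℤ.+ 1) (ℤ.+≤+ m≤n)))

fromℕ-cancel : ∀ {m n} → fromℕ m ≤ᴿ fromℕ n → m ≤ n
fromℕ-cancel {m} {n} m≤n with m ℕ.≤? n
... | yes p = p
-- For `n < m` the rational `n` lies in the lower cut of `m`, hence in its own.
... | no m≰n = contradiction (m≤n (ℚ.*<* (ℤ.*-monoʳ-<-pos (ℤ.+ 1) (ℤ.+<+ (ℕ.≰⇒> m≰n))))) (ℚ.<-irrefl refl)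

-- Intervals through their endpoints, up to double negation.

¬¬-∀ : ∀ {ℓ n} {P : Fin n → Set ℓ} → (∀ i → ¬ ¬ P i) → ¬ ¬ (∀ i → P i)
¬¬-∀ {n = zero}  ¬¬P k = k λ ()
¬¬-∀ {n = suc n} ¬¬P k = ¬¬P zero λ P0 → ¬¬-∀ (¬¬P ∘ suc) λ Ps → k λ { zero → P0 ; (suc i) → Ps i }

-- A missing endpoint is infinite: −∞ on the left of _≤ᴹ_ and +∞ on its right.
infix 4 _≤ᴹ_
_≤ᴹ_ : Maybe ℝ → Maybe ℝ → Set
just a ≤ᴹ just b = a ≤ᴿ b
just _ ≤ᴹ nothing = ⊤
nothing ≤ᴹ _ = ⊤

lower upper : Interval → Maybe ℝ
lower (bounded a b _) = just a
lower (from a)        = just a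
lower (upTo b)        = nothing
lower line            = nothing
upper (bounded a b _) = just b
upper (from a)        = nothing
upper (upTo b)        = just b
upper line            = nothing

∈ᴵ⇔ : ∀ x I → x ∈ᴵ I ⇔ (lower I ≤ᴹ just x × just x ≤ᴹ upper I)
∈ᴵ⇔ x (bounded a b _) = mk⇔ (λ p → p) (λ p → p)
∈ᴵ⇔ x (from a)        = mk⇔ (λ p → p , tt) proj₁
∈ᴵ⇔ x (upTo b)        = mk⇔ (λ p → tt , p) proj₂
∈ᴵ⇔ x line            = mk⇔ (λ p → tt , tt) (λ _ → tt)

lower≤upper : ∀ I → lower I ≤ᴹ upper I
lower≤upper (bounded _ _ a≤b) = a≤b
lower≤upper (from _)          = tt
lower≤upper (upTo _)          = tt
lower≤upper line              = tt

≤ᴹ-trans : ∀ a x b → a ≤ᴹ just x → just x ≤ᴹ b → a ≤ᴹ b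
≤ᴹ-trans nothing  x b        _ _ = tt
≤ᴹ-trans (just a) x nothing  _ _ = tt
≤ᴹ-trans (just a) x (just b) a≤x x≤b p∈a = x≤b (a≤x p∈a)

infix 4 _before_
_before_ : Interval → Interval → Set
I before J = ¬ lower J ≤ᴹ upper I

-- For finite endpoints the first three hypotheses give c < d ≤ a < b.
before-ferrers : ∀ a b c d → ¬ b ≤ᴹ a → ¬ d ≤ᴹ c → d ≤ᴹ a → ¬ b ≤ᴹ c
before-ferrers (just a) (just b) (just c) (just d) b≰a d≰c d≤a b≤c =
  d≰c λ p∈d → b≤c (≰ᴿ⇒≥ᴿ b a b≰a (d≤a p∈d))
before-ferrers a nothing c d b≰a d≰c _ _ = b≰a tt
before-ferrers nothing (just b) c d b≰a d≰c _ _ = b≰a tt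
before-ferrers (just a) (just b) c nothing b≰a d≰c _ _ = d≰c tt
before-ferrers (just a) (just b) nothing (just d) b≰a d≰c _ _ = d≰c tt

-- The left end of an intersection is the larger of the two left ends; it is selected by comparing
-- reals, hence the double negation.
∩-lower : ∀ a b → ¬ ¬ (∃[ c ] ((∀ x → c ≤ᴹ x → a ≤ᴹ x × b ≤ᴹ x) × (∀ x → a ≤ᴹ x → b ≤ᴹ x → c ≤ᴹ x)))
∩-lower nothing  b        k = k (b , (λ _ b≤x → tt , b≤x) , λ _ _ b≤x → b≤x)
∩-lower (just a) nothing  k = k (just a , (λ _ a≤x → a≤x , tt) , λ _ a≤x _ → a≤x)
∩-lower (just a) (just b) k = ¬¬-excluded-middle {A = a ≤ᴿ b} λ
  { (yes a≤b) → k (just b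
      , (λ { (just x) b≤x → (λ p → b≤x (a≤b p)) , b≤x ; nothing _ → tt , tt }) , λ _ _ b≤x → b≤x)
  ; (no a≰b)  → k (just a
      , (λ { (just x) a≤x → a≤x , (λ p → a≤x (≰ᴿ⇒≥ᴿ a b a≰b p)) ; nothing _ → tt , tt }) , λ _ a≤x _ → a≤x) }

∩-upper : ∀ a b → ¬ ¬ (∃[ c ] ((∀ x → x ≤ᴹ c → x ≤ᴹ a × x ≤ᴹ b) × (∀ x → x ≤ᴹ a → x ≤ᴹ b → x ≤ᴹ c)))
∩-upper nothing  b        k = k (b , (λ { (just _) x≤b → tt , x≤b ; nothing _ → tt , tt }) , λ _ _ x≤b → x≤b)
∩-upper (just a) nothing  k = k (just a , (λ { (just _) x≤a → x≤a , tt ; nothing _ → tt , tt }) , λ _ x≤a _ → x≤a)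
∩-upper (just a) (just b) k = ¬¬-excluded-middle {A = a ≤ᴿ b} λ
  { (yes a≤b) → k (just a
      , (λ { (just x) x≤a → x≤a , (λ p → a≤b (x≤a p)) ; nothing _ → tt , tt }) , λ _ x≤a _ → x≤a)
  ; (no a≰b)  → k (just b
      , (λ { (just x) x≤b → (λ p → ≰ᴿ⇒≥ᴿ a b a≰b (x≤b p)) , x≤b ; nothing _ → tt , tt }) , λ _ _ x≤b → x≤b) }

between : ∀ a b → a ≤ᴹ b → ∃[ x ] (a ≤ᴹ just x × just x ≤ᴹ b)
between (just a) nothing  _   = a , (λ p → p) , tt
between (just a) (just b) a≤b = a , (λ p → p) , a≤b
between nothing  (just b) _   = b , tt , λ p → p
between nothing  nothing  _   = fromℚ 0ℚ , tt , tt

-- The larger left end does not exceed the smaller right end: of the four inequalities, two say that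
-- the intervals are nonempty and two that neither lies before the other.
common-point : ∀ I J → ¬ I before J → ¬ J before I → ¬ ¬ (∃[ x ] (x ∈ᴵ I × x ∈ᴵ J))
common-point I J I⊀J J⊀I k =
  I⊀J λ lJ≤uI → J⊀I λ lI≤uJ →
  ∩-lower (lower I) (lower J) λ (l , l-lower , l-greatest) →
  ∩-upper (upper I) (upper J) λ (u , u-upper , u-least) →
  let x , l≤x , x≤u = between l u (u-least l (l-greatest (upper I) (lower≤upper I) lJ≤uI)
                                             (l-greatest (upper J) lI≤uJ (lower≤upper J)))
      lI≤x , lJ≤x = l-lower (just x) l≤x
      x≤uI , x≤uJ = u-upper (just x) x≤u
  in k (x , ⇔-from (∈ᴵ⇔ x I) (lI≤x , x≤uI) , ⇔-from (∈ᴵ⇔ x J) (lJ≤x , x≤uJ))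

common-point⇒¬before : ∀ {x} I J → x ∈ᴵ I → x ∈ᴵ J → ¬ I before J
common-point⇒¬before {x} I J x∈I x∈J I≺J =
  I≺J (≤ᴹ-trans (lower J) x (upper I) (proj₁ (to (∈ᴵ⇔ x J) x∈J)) (proj₂ (to (∈ᴵ⇔ x I) x∈I)))

-- Boxicity through interval orders.

least : {P : ℕ → Set} → (∀ n → Dec (P n)) → ∀ N → P N →
        ∃[ b ] (b ≤ N × P b × (∀ d → P d → b ≤ d))
least P? zero PN = zero , z≤n , PN , λ _ _ → z≤n
least {P} P? (suc N) PN with P? zero
... | yes P0 = zero , z≤n , P0 , λ _ _ → z≤n
... | no ¬P0 with b , b≤N , Pb , minimal ← least (P? ∘ suc) N PN
    = suc b , s≤s b≤N , Pb , λ { zero P0 → contradiction P0 ¬P0 ; (suc d) Pd → s≤s (minimal d Pd) }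

module Boxicity {m : ℕ} (F : Graph m) where
  open Graph F

  record IsOrderRepresentation {d : ℕ} (R : Fin d → Rel (Fin m) 0ℓ) : Set where
    field
      isIntervalOrder : ∀ i → IsIntervalOrder (R i)
      separated       : ∀ u v → u ≢ v → ¬ u ~ v → ∃[ i ] (R i u v ⊎ R i v u)
      adjacent        : ∀ i u v → u ~ v → ¬ R i u v

  -- Coding the relations as subsets of a finite set makes the existence of a representation decidable.
  decode : ∀ d → Subset (d * (m * m)) → Fin d → Rel (Fin m) 0ℓ
  decode d S i u v = T (Vec.lookup S (combine i (combine u v)))

  decode? : ∀ d S i → Decidable (decode d S i)
  decode? d S i u v = T? _

  HasOrderRepresentation : ℕ → Set
  HasOrderRepresentation d = ∃[ S ] IsOrderRepresentation (decode d S)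

  isOrderRepresentation? : ∀ d S → Dec (IsOrderRepresentation (decode d S))
  isOrderRepresentation? d S = map′
    (λ (irr , fer , sep , adj) → record
      { isIntervalOrder = λ i → record { irrefl = irr i ; ferrers = fer i }
      ; separated = sep ; adjacent = adj })
    (λ rep → let open IsOrderRepresentation rep in
      (λ i → IsIntervalOrder.irrefl (isIntervalOrder i)) ,
      (λ i → IsIntervalOrder.ferrers (isIntervalOrder i)) , separated , adjacent)
    ( (Fin.all? λ i → Fin.all? λ x → ¬? (R? i x x))
    ×-dec (Fin.all? λ i → Fin.all? λ w → Fin.all? λ x → Fin.all? λ y → Fin.all? λ z →
            R? i w x →-dec R? i y z →-dec (R? i w z ⊎-dec R? i y x))
    ×-dec (Fin.all? λ u → Fin.all? λ v → ¬? (u Fin.≟ v) →-dec ¬? (u ~? v) →-dec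
            Fin.any? λ i → R? i u v ⊎-dec R? i v u)
    ×-dec (Fin.all? λ i → Fin.all? λ u → Fin.all? λ v → (u ~? v) →-dec ¬? (R? i u v)))
    where R? = decode? d S

  hasOrderRepresentation? : ∀ d → Dec (HasOrderRepresentation d)
  hasOrderRepresentation? d = anySubset? (isOrderRepresentation? d)

  encode : ∀ {d} {R : Fin d → Rel (Fin m) 0ℓ} → (∀ i u v → Dec (R i u v)) →
           IsOrderRepresentation R → HasOrderRepresentation d
  encode {d} {R} R? rep = S , record
    { isIntervalOrder = λ i → record
      { irrefl  = λ x x≺x → irrefl i x (decoded x≺x)
      ; ferrers = λ w x y z w≺x y≺z → Sum.map encoded encoded
                    (ferrers i w x y z (decoded w≺x) (decoded y≺z)) }
    ; separated = λ u v u≢v u≁v → let i , r = separated u v u≢v u≁v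
                                  in i , Sum.map encoded encoded r
    ; adjacent = λ i u v u~v r → adjacent i u v u~v (decoded r)
    }
    where
    open IsOrderRepresentation rep
    open module Orders i = IsIntervalOrder (isIntervalOrder i) using (irrefl; ferrers)
    triple : Fin (d * (m * m)) → Fin d × Fin m × Fin m
    triple x = let i , uv = remQuot {d} (m * m) x in i , remQuot {m} m uv
    triple-combine : ∀ i u v → triple (combine i (combine u v)) ≡ (i , u , v)
    triple-combine i u v = trans
      (cong (λ (i , uv) → i , remQuot {m} m uv) (Fin.remQuot-combine i (combine u v)))
      (cong (i ,_) (Fin.remQuot-combine u v))
    bit : Fin d × Fin m × Fin m → Bool
    bit (i , u , v) = ⌊ R? i u v ⌋
    S : Subset (d * (m * m))
    S = tabulate (bit ∘ triple)
    decode-S : ∀ i u v → Vec.lookup S (combine i (combine u v)) ≡ ⌊ R? i u v ⌋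
    decode-S i u v = trans (lookup∘tabulate (bit ∘ triple) _) (cong bit (triple-combine i u v))
    decoded : ∀ {i u v} → decode d S i u v → R i u v
    decoded {i} {u} {v} r = toWitness {a? = R? i u v} (subst T (decode-S i u v) r)
    encoded : ∀ {i u v} → R i u v → decode d S i u v
    encoded {i} {u} {v} r = subst T (sym (decode-S i u v)) (fromWitness {a? = R? i u v} r)

  -- The relation `before` need not be decidable, but it has finitely many instances here. Under a
  -- double negation all of them may be taken as decided and encoded; decidability of the conclusion
  -- then removes the double negation.
  box⇒order : ∀ {d} → HasBoxRepresentation F d → HasOrderRepresentation d
  box⇒order {d} (B , B-rep) = decidable-stable (hasOrderRepresentation? d) λ k →
    ¬¬-∀ (λ i → ¬¬-∀ λ u → ¬¬-∀ λ v → ¬¬-excluded-middle) λ R? → k (encode R? (order-rep R?))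
    where
    R : Fin d → Rel (Fin m) 0ℓ
    R i u v = B u i before B v i
    order-rep : (∀ i u v → Dec (R i u v)) → IsOrderRepresentation R
    order-rep R? = record
      { isIntervalOrder = λ i → record
        { irrefl  = λ x x≺x → x≺x (lower≤upper (B x i))
        ; ferrers = λ w x y z w≺x y≺z → decidable-stable (R? i w z ⊎-dec R? i y x) λ none →
            none (inj₁ λ z≤w → none (inj₂ λ x≤y →
              before-ferrers (upper (B w i)) (lower (B x i)) (upper (B y i)) (lower (B z i)) w≺x y≺z z≤w x≤y)) }
      ; separated = λ u v u≢v u≁v → decidable-stable (Fin.any? λ i → R? i u v ⊎-dec R? i v u) λ none →
          ¬¬-∀ (λ i → common-point (B u i) (B v i) (λ r → none (i , inj₁ r)) (λ r → none (i , inj₂ r)))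
            λ points → u≁v (⇔-from (B-rep u v u≢v)
              ((λ i → proj₁ (points i)) , (λ i → proj₁ (proj₂ (points i))) , (λ i → proj₂ (proj₂ (points i)))))
      ; adjacent = λ i u v u~v →
          let x , x∈u , x∈v = to (B-rep u v λ u≡v → ~-irrefl u≡v u~v) u~v
          in common-point⇒¬before (B u i) (B v i) (x∈u i) (x∈v i)
      }

  natural⇒box : ∀ {d} (l r : Fin d → Fin m → ℕ) → (∀ i u → l i u ≤ r i u) →
    (∀ u v → u ≢ v → u ~ v ⇔ (∀ i → l i u ≤ r i v × l i v ≤ r i u)) → HasBoxRepresentation F d
  natural⇒box l r l≤r rep =
    boxes , λ u v u≢v → mk⇔ (meet u v ∘ to (rep u v u≢v)) (⇔-from (rep u v u≢v) ∘ overlapping u v)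
    where
    boxes : Fin m → Box _
    boxes u i = bounded (fromℕ (l i u)) (fromℕ (r i u)) (fromℕ-mono (l≤r i u))
    meet : ∀ u v → (∀ i → l i u ≤ r i v × l i v ≤ r i u) → Intersect (boxes u) (boxes v)
    meet u v lr = (λ i → fromℕ (l i u ⊔ l i v))
      , (λ i → fromℕ-mono (ℕ.m≤m⊔n (l i u) (l i v)) , fromℕ-mono (ℕ.⊔-lub (l≤r i u) (proj₂ (lr i))))
      , (λ i → fromℕ-mono (ℕ.m≤n⊔m (l i u) (l i v)) , fromℕ-mono (ℕ.⊔-lub (proj₁ (lr i)) (l≤r i v)))
    overlapping : ∀ u v → Intersect (boxes u) (boxes v) → ∀ i → l i u ≤ r i v × l i v ≤ r i u
    overlapping u v (x , x∈u , x∈v) i =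
      fromℕ-cancel (λ p → proj₂ (x∈v i) (proj₁ (x∈u i) p)) , fromℕ-cancel (λ p → proj₂ (x∈u i) (proj₁ (x∈v i) p))

  -- The canonical interval representation: an element starts at its number of predecessors and ends
  -- at the latest start among the elements that it does not precede.
  order⇒box : ∀ {d} → HasOrderRepresentation d → HasBoxRepresentation F d
  order⇒box {d} (S , rep) = natural⇒box l r (λ i u → ⊥≤max (l i u) (ranks i u)) λ u v u≢v →
    mk⇔ (λ u~v i → l≤r (adjacent i v u (~-sym u~v)) , l≤r (adjacent i u v u~v))
        (λ lr → decidable-stable (u ~? v) λ u≁v → case separated u v u≢v u≁v of λ
          { (i , inj₁ u≺v) → ℕ.<⇒≱ (r<l u≺v) (proj₂ (lr i))
          ; (i , inj₂ v≺u) → ℕ.<⇒≱ (r<l v≺u) (proj₁ (lr i)) })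
    where
    open IsOrderRepresentation rep
    R : Fin d → Rel (Fin m) 0ℓ
    R = decode d S
    R? : ∀ i → Decidable (R i)
    R? = decode? d S
    predecessors : Fin d → Fin m → List (Fin m)
    predecessors i v = filter (λ u → R? i u v) (allFin m)
    l : Fin d → Fin m → ℕ
    l i v = length (predecessors i v)
    ranks : Fin d → Fin m → List ℕ
    ranks i u = map (l i) (filter (λ w → ¬? (R? i u w)) (allFin m))
    r : Fin d → Fin m → ℕ
    r i u = max (l i u) (ranks i u)
    l≤r : ∀ {i u v} → ¬ R i u v → l i v ≤ r i u
    l≤r {i} {u} {v} u⊀v = All.lookup (xs≤max (l i u) (ranks i u))
      (∈-map⁺ (l i) (∈-filter⁺ (λ w → ¬? (R? i u w)) (∈-allFin v) u⊀v))
    -- By the Ferrers condition every predecessor of `w` precedes `v`, and `u` is one predecessor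
    -- more.
    l<l : ∀ {i u v w} → R i u v → ¬ R i u w → l i w ℕ.< l i v
    l<l {i} {u} {v} {w} u≺v u⊀w = AtMost.bound (atMost-∈ (predecessors i v)) (u ∷ predecessors i w)
      (All.tabulate (λ { x∈w refl → u⊀w (proj₂ (∈-filter⁻ (λ x → R? i x w) {xs = allFin m} x∈w)) })
        ∷ Unique.filter⁺ (λ x → R? i x w) (Unique.allFin⁺ m))
      (∈-filter⁺ (λ x → R? i x v) (∈-allFin u) u≺v
        ∷ All.tabulate λ {x} x∈w →
          let x≺w = proj₂ (∈-filter⁻ (λ x → R? i x w) {xs = allFin m} x∈w)
          in ∈-filter⁺ (λ x → R? i x v) (∈-allFin x) 
               (case IsIntervalOrder.ferrers (isIntervalOrder i) u v x w u≺v x≺w of λ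
               { (inj₁ u≺w) → contradiction u≺w u⊀w
               ; (inj₂ x≺v) → x≺v }))
    r<l : ∀ {i u v} → R i u v → r i u ℕ.< l i v
    r<l {i} {u} {v} u≺v = max<v⁺ (l<l u≺v (IsIntervalOrder.irrefl (isIntervalOrder i) u))
      (All.map⁺ (All.tabulate λ w∈ → l<l u≺v (proj₂ (∈-filter⁻ (λ w → ¬? (R? i u w)) {xs = allFin m} w∈))))

  boxicity : ∀ {N} → HasBoxRepresentation F N → ∃[ b ] (IsBoxicity F b × b ≤ N × HasOrderRepresentation b)
  boxicity {N} box =
    let b , b≤N , rep , minimal = least hasOrderRepresentation? N (box⇒order box)
    in b , (order⇒box rep , λ d box′ → minimal d (box⇒order box′)) , b≤N , rep

-- The upper bound: a representation in n - 2 dimensions.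

module UpperBound {N : ℕ} (G : Graph (2 + N)) where
  open LineGraph G

  pattern first = zero
  pattern last = suc zero
  pattern inner i = suc (suc i)

  -- Every coordinate uses this order of the vertices to place an edge by its other end. The fixed
  -- vertices p and q, here `first` and `last`, take the extreme positions.
  code : Fin (2 + N) → ℕ
  code first     = 0
  code last      = suc N
  code (inner i) = suc (toℕ i)

  code-injective : ∀ x y → code x ≡ code y → x ≡ y
  code-injective first     first     _  = refl
  code-injective first     last      ()
  code-injective first     (inner _) ()
  code-injective last      first     ()
  code-injective (inner _) first     ()
  code-injective last      last      _  = refl
  code-injective last      (inner j) eq = contradiction (sym (ℕ.suc-injective eq)) (ℕ.<⇒≢ (Fin.toℕ<n j))
  code-injective (inner i) last      eq = contradiction (ℕ.suc-injective eq) (ℕ.<⇒≢ (Fin.toℕ<n i))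
  code-injective (inner i) (inner j) eq = cong (λ k → inner k) (Fin.toℕ-injective (ℕ.suc-injective eq))

  code<1⇒first : ∀ x → code x < 1 → x ≡ first
  code<1⇒first first     _        = refl
  code<1⇒first last      (s≤s ())
  code<1⇒first (inner _) (s≤s ())

  N<code⇒last : ∀ x → N < code x → x ≡ last
  N<code⇒last last      _         = refl
  N<code⇒last (inner i) (s≤s N≤i) = contradiction N≤i (ℕ.<⇒≱ (Fin.toℕ<n i))

  code≤1+N : ∀ x → code x ≤ suc N
  code≤1+N first     = z≤n
  code≤1+N last      = ≤-refl
  code≤1+N (inner i) = s≤s (ℕ.<⇒≤ (Fin.toℕ<n i))

  -- Starting at 1 instead of 0 misses `code first`, the point of the edge from `first` to the
  -- chosen inner vertex. `High` mirrors this at `code last`.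
  data Low (e : Edge) : ℕ → Set where
    with-first    : first ∈ᵉ e → Low e 1
    without-first : ¬ first ∈ᵉ e → Low e 0

  data High (e : Edge) : ℕ → Set where
    with-last    : last ∈ᵉ e → High e N
    without-last : ¬ last ∈ᵉ e → High e (suc N)

  -- The i-th coordinate makes the edges at inner i pairwise disjoint points, the one to first leftmost and
  -- the one to last rightmost; among the other edges only those at first or last avoid one of these two.
  data Span (i : Fin N) (e : Edge) : ℕ → ℕ → Set where
    at    : ∀ {x} → inner i ∈ᵉ e → x ∈ᵉ e → x ≢ inner i → Span i e (code x) (code x)
    avoid : ∀ {l r} → ¬ inner i ∈ᵉ e → Low e l → High e r → Span i e l r

  low : ∀ e → ∃[ l ] Low e l
  low e with first ∈ᵉ? e
  ... | yes p = 1 , with-first p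
  ... | no ¬p = 0 , without-first ¬p

  high : ∀ e → ∃[ r ] High e r
  high e with last ∈ᵉ? e
  ... | yes p = N , with-last p
  ... | no ¬p = suc N , without-last ¬p

  span : ∀ i e → ∃[ l ] ∃[ r ] Span i e l r
  span i e with inner i ∈ᵉ? e
  ... | yes v∈e = let x , x∈e , x≢v , _ = otherEnd v∈e in code x , code x , at v∈e x∈e x≢v
  ... | no v∉e  = let l , lo = low e ; r , hi = high e in l , r , avoid v∉e lo hi

  low≤1 : ∀ {e l} → Low e l → l ≤ 1
  low≤1 (with-first _)    = ≤-refl
  low≤1 (without-first _) = z≤n

  N≤high : ∀ {e r} → High e r → N ≤ r
  N≤high (with-last _)    = ≤-refl
  N≤high (without-last _) = ℕ.n≤1+n N

  -- The index supplies 1 ≤ `N`.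
  low≤high : ∀ {e f l r} → Fin N → Low e l → High f r → l ≤ r
  low≤high i lo hi = ≤-trans (low≤1 lo) (≤-trans (≤-trans (s≤s z≤n) (Fin.toℕ<n i)) (N≤high hi))

  span-≤ : ∀ {i e l r} → Span i e l r → l ≤ r
  span-≤     (at _ _ _)      = ≤-refl
  span-≤ {i} (avoid _ lo hi) = low≤high i lo hi

  -- Two points belong to edges sharing `inner i`, and two long intervals overlap. A point to the
  -- left of a long interval can only be 0, so both edges contain `first`; on the right both contain
  -- `last`.
  disjoint⇒meet : ∀ {i e f l r l′ r′} → Span i e l r → Span i f l′ r′ → r < l′ → ∃[ v ] (v ∈ᵉ e × v ∈ᵉ f)
  disjoint⇒meet (at v∈e _ _) (at v∈f _ _) _ = _ , v∈e , v∈f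
  disjoint⇒meet {e = e} (at {x} _ x∈e _) (avoid _ (with-first p) _) r<l′ =
    first , subst (_∈ᵉ e) (code<1⇒first x r<l′) x∈e , p
  disjoint⇒meet {f = f} (avoid _ _ (with-last p)) (at {x} _ x∈f _) r<l′ =
    last , p , subst (_∈ᵉ f) (N<code⇒last x r<l′) x∈f
  disjoint⇒meet (avoid _ _ (without-last _)) (at {x} _ _ _) r<l′ = contradiction (code≤1+N x) (ℕ.<⇒≱ r<l′)
  disjoint⇒meet {i} (avoid _ _ hi) (avoid _ lo _) r<l′ = contradiction (low≤high i lo hi) (ℕ.<⇒≱ r<l′)

  inner-disjoint : ∀ {i e f l r l′ r′} → e ≢ f → inner i ∈ᵉ e → inner i ∈ᵉ f →
                   Span i e l r → Span i f l′ r′ → r < l′ ⊎ r′ < l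
  inner-disjoint _ v∈e _ (avoid v∉e _ _) _ = contradiction v∈e v∉e
  inner-disjoint _ _ v∈f _ (avoid v∉f _ _) = contradiction v∈f v∉f
  inner-disjoint e≢f v∈e v∈f (at {x} _ x∈e x≢v) (at {y} _ y∈f _) with ℕ.<-cmp (code x) (code y)
  ... | tri< x<y _ _ = inj₁ x<y
  ... | tri> _ _ y<x = inj₂ y<x
  ... | tri≈ _ eq _  with refl ← code-injective x y eq = contradiction (edge-from-ends x≢v x∈e v∈e y∈f v∈f) e≢f

  first-disjoint : ∀ {i e f l r l′ r′} → e ≢ f → first ∈ᵉ e → inner i ∈ᵉ e → first ∈ᵉ f →
                   Span i e l r → Span i f l′ r′ → r < l′
  first-disjoint _ _ v∈e _ (avoid v∉e _ _) _ = contradiction v∈e v∉e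
  first-disjoint e≢f p∈e v∈e p∈f _ (at v∈f _ _) = contradiction (edge-from-ends (λ ()) p∈e v∈e p∈f v∈f) e≢f
  first-disjoint _ _ _ p∈f _ (avoid _ (without-first p∉f) _) = contradiction p∈f p∉f
  first-disjoint _ p∈e v∈e _ (at _ x∈e x≢v) (avoid _ (with-first _) _)
    with refl ← same-end v∈e x∈e p∈e x≢v (λ ()) = ≤-refl

  last-disjoint : ∀ {i e f l r l′ r′} → e ≢ f → last ∈ᵉ e → inner i ∈ᵉ e → last ∈ᵉ f →
                  Span i e l r → Span i f l′ r′ → r′ < l
  last-disjoint _ _ v∈e _ (avoid v∉e _ _) _ = contradiction v∈e v∉e
  last-disjoint e≢f q∈e v∈e q∈f _ (at v∈f _ _) = contradiction (edge-from-ends (λ ()) q∈e v∈e q∈f v∈f) e≢f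
  last-disjoint _ _ _ q∈f _ (avoid _ _ (without-last q∉f)) = contradiction q∈f q∉f
  last-disjoint _ q∈e v∈e _ (at _ x∈e x≢v) (avoid _ _ (with-last _))
    with refl ← same-end v∈e x∈e q∈e x≢v (λ ()) = ≤-refl

  -- A common inner end gives the coordinate at once. Two distinct edges at `first` cannot both end
  -- at `last`, so one of them has an inner end, whose coordinate is used; the case of `last` is
  -- symmetric.
  meet⇒disjoint : ∀ {e f} → e ~ᴴ f →
    ∃[ i ] (∀ {l r l′ r′} → Span i e l r → Span i f l′ r′ → r < l′ ⊎ r′ < l)
  meet⇒disjoint (e≢f , inner i , v∈e , v∈f) = i , inner-disjoint e≢f v∈e v∈f
  meet⇒disjoint (e≢f , first , p∈e , p∈f) with otherEnd p∈e | otherEnd p∈f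
  ... | first , _ , x≢p , _   | _                         = contradiction refl x≢p
  ... | inner i , x∈e , _     | _                         = i , λ s t → inj₁ (first-disjoint e≢f p∈e x∈e p∈f s t)
  ... | _                     | first , _ , y≢p , _       = contradiction refl y≢p
  ... | last , _              | inner i , y∈f , _         = i , λ s t → inj₂ (first-disjoint (≢-sym e≢f) p∈f y∈f p∈e t s)
  ... | last , x∈e , x≢p , _  | last , y∈f , _            = contradiction (edge-from-ends x≢p x∈e p∈e y∈f p∈f) e≢f
  meet⇒disjoint (e≢f , last , q∈e , q∈f) with otherEnd q∈e | otherEnd q∈f
  ... | last , _ , x≢q , _    | _                         = contradiction refl x≢q
  ... | inner i , x∈e , _     | _                         = i , λ s t → inj₂ (last-disjoint e≢f q∈e x∈e q∈f s t)
  ... | _                     | last , _ , y≢q , _        = contradiction refl y≢q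
  ... | first , _             | inner i , y∈f , _         = i , λ s t → inj₁ (last-disjoint (≢-sym e≢f) q∈f y∈f q∈e t s)
  ... | first , x∈e , x≢q , _ | first , y∈f , _           = contradiction (edge-from-ends x≢q x∈e q∈e y∈f q∈f) e≢f

  box : HasBoxRepresentation (complement H) N
  box = Boxicity.natural⇒box (complement H) l r (λ i e → span-≤ (spans i e)) λ e f e≢f → mk⇔
    (λ (_ , e≁f) i →
        ℕ.≮⇒≥ (λ lt → let v , v∈f , v∈e = disjoint⇒meet (spans i f) (spans i e) lt in e≁f (e≢f , v , v∈e , v∈f))
      , ℕ.≮⇒≥ (λ lt → e≁f (e≢f , disjoint⇒meet (spans i e) (spans i f) lt)))
    (λ lr → e≢f , λ e~f → let i , disjoint = meet⇒disjoint e~f in clash (lr i) (disjoint (spans i e) (spans i f)))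
    where
    l r : Fin N → Edge → ℕ
    l i e = proj₁ (span i e)
    r i e = proj₁ (proj₂ (span i e))
    spans : ∀ i e → Span i e (l i e) (r i e)
    spans i e = proj₂ (proj₂ (span i e))
    clash : ∀ {a b c d} → a ≤ d × c ≤ b → ¬ (b < c ⊎ d < a)
    clash (_ , c≤b) (inj₁ b<c) = ℕ.<⇒≱ b<c c≤b
    clash (a≤d , _) (inj₂ d<a) = ℕ.<⇒≱ d<a a≤d

edgeless-box : ∀ {n} (G : Graph n) → ¬ Fin (∣E∣ G) → HasBoxRepresentation (complement (lineGraph G)) 0
edgeless-box G ¬e = Boxicity.natural⇒box (complement (lineGraph G)) (λ ()) (λ ()) (λ ()) λ e → contradiction e ¬e

-- With fewer than two vertices there are no edges, and the truncated difference is 0.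
box-n∸2 : ∀ n (G : Graph n) → HasBoxRepresentation (complement (lineGraph G)) (n ∸ 2)
box-n∸2 zero G = edgeless-box G λ e → Fin.¬Fin0 (LineGraph.source G e)
box-n∸2 (suc zero) G = edgeless-box G λ e →
  Fin.<-irrefl (Fin1-! (LineGraph.source G e) (LineGraph.target G e)) (LineGraph.source<target G e)
  where
  Fin1-! : (i j : Fin 1) → i ≡ j
  Fin1-! zero zero = refl
box-n∸2 (suc (suc N)) G = UpperBound.box G

-- The lower bound: covering the edges of the line graph.

module _ {n : ℕ} (G : Graph n) where
  open LineGraph G

  -- An edge of `H` is a non-edge of the complement, so some order compares its ends, and each order
  -- compares only adjacent vertices of `H`.
  atMost-edges : ∀ {d} → Boxicity.HasOrderRepresentation (complement H) d → ∣E∣ H ≤ d * pairBound Δ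
  atMost-edges {d} (S , rep) = AtMost.bound (atMost-⊆ covered (atMost-⋃ atMost-unordered)) (edges H)
    (LineGraph.edges-unique H) (All.tabulate λ z∈ →
      proj₂ (∈-filter⁻ (λ (e , f) → (e Fin.<? f) ×-dec (e ~?ᴴ f)) {xs = cartesianProduct (allFin _) (allFin _)} z∈))
    where
    open Graph H using () renaming (_~?_ to _~?ᴴ_)
    open Boxicity (complement H)
    open IsOrderRepresentation rep
    R : Fin d → Rel Edge 0ℓ
    R = decode d S
    R⇒~ : ∀ i {e f} → R i e f → e ~ᴴ f
    R⇒~ i {e} {f} r = decidable-stable (e ~?ᴴ f) λ e≁f →
      adjacent i e f ((λ { refl → IsIntervalOrder.irrefl (isIntervalOrder i) e r }) , e≁f) r
    Unordered : Fin d → Pred (Edge × Edge) 0ℓ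
    Unordered i (e , f) = e Fin.< f × (R i e f ⊎ R i f e)
    covered : ∀ {z} → proj₁ z Fin.< proj₂ z × proj₁ z ~ᴴ proj₂ z → ∃[ i ] Unordered i z
    covered {e , f} (e<f , e~f) =
      let i , r = separated e f (proj₁ e~f) (λ (_ , e≁f) → e≁f e~f) in i , e<f , r
    atMost-unordered : ∀ i → AtMost (Unordered i) (pairBound Δ)
    -- Swapping a pair that is compared in reverse remains injective, because `e < f` tells which
    -- orientation is the listed one.
    atMost-unordered i = atMost-image (λ x y → x ≡ y ⊎ x ≡ (proj₂ y , proj₁ y))
      (λ { (e , f) (_ , inj₁ r) → (e , f) , r , inj₁ refl
         ; (e , f) (_ , inj₂ r) → (f , e) , r , inj₂ refl })
      (λ { _ _ (inj₁ refl) (inj₁ refl) → refl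
         ; (e<f , _) (f<e , _) (inj₁ refl) (inj₂ refl) → contradiction f<e (Fin.<-asym e<f)
         ; (e<f , _) (f<e , _) (inj₂ refl) (inj₁ refl) → contradiction f<e (Fin.<-asym e<f)
         ; _ _ (inj₂ refl) (inj₂ refl) → refl })
      (atMost-comparable G (R i) (decode? d S i) (isIntervalOrder i) (R⇒~ i))

-- Evaluation of the bounds and conclusion.

2*triangular : ∀ k → 2 * triangular (suc k) ≡ suc k * k
2*triangular zero    = refl
2*triangular (suc k) = begin
  2 * (suc k + triangular (suc k))     ≡⟨ expand k (triangular (suc k)) ⟩
  2 * suc k + 2 * triangular (suc k)   ≡⟨ cong (2 * suc k +_) (2*triangular k) ⟩
  2 * suc k + suc k * k                ≡⟨ collect k ⟩
  suc (suc k) * suc k                  ∎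
  where
  open ≡-Reasoning
  expand : ∀ k t → 2 * (suc k + t) ≡ 2 * suc k + 2 * t
  expand = solve-∀
  collect : ∀ k → 2 * suc k + suc k * k ≡ suc (suc k) * suc k
  collect = solve-∀

2*pairBound : ∀ {d} → 5 ≤ d → 2 * pairBound d ≡ d ^ 2 + 3 * d
-- With `d = 5 + k` the maximum in `commonBound` is its star term `4 + k`; it computes down to
-- `k ⊔ 0`, which the rewrite removes.
2*pairBound 5≤d with k , refl ← ℕ.m≤n⇒∃[o]m+o≡n 5≤d rewrite ℕ.⊔-identityʳ k = begin
  2 * (2 * (4 + k) + ((3 + k + (4 + k + 0)) + ((3 + k) + ((2 + k) + triangular (suc k)))))
    ≡⟨ expand k (triangular (suc k)) ⟩
  40 + 12 * k + 2 * triangular (suc k)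
    ≡⟨ cong (40 + 12 * k +_) (2*triangular k) ⟩
  40 + 12 * k + suc k * k
    ≡⟨ collect k ⟩
  (5 + k) ^ 2 + 3 * (5 + k) ∎
  where
  open ≡-Reasoning
  expand : ∀ k t → 2 * (2 * (4 + k) + ((3 + k + (4 + k + 0)) + ((3 + k) + ((2 + k) + t)))) ≡ 40 + 12 * k + 2 * t
  expand = solve-∀
  collect : ∀ k → 40 + 12 * k + suc k * k ≡ (5 + k) * ((5 + k) * 1) + 3 * (5 + k)
  collect = solve-∀

explicit-bounds : ∀ {d e b} → e ≤ pairBound d * b →
  (d ≡ 3 → e ≤ 12 * b) × (d ≡ 4 → e ≤ 16 * b) × (5 ≤ d → 2 * e ≤ (d ^ 2 + 3 * d) * b)
-- `pairBound` evaluates to 4 + 3 + 3 + 2 + 0 = 12 at 3 and to 6 + 5 + 3 + 2 + 0 = 16 at 4; in both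
-- cases the 4 in `commonBound` is the maximum.
explicit-bounds {d} {e} {b} e≤ = (λ { refl → e≤ }) , (λ { refl → e≤ }) , λ 5≤d → begin
  2 * e                    ≤⟨ ℕ.*-monoʳ-≤ 2 e≤ ⟩
  2 * (pairBound d * b)    ≡⟨ ℕ.*-assoc 2 (pairBound d) b ⟨
  2 * pairBound d * b      ≡⟨ cong (_* b) (2*pairBound 5≤d) ⟩
  (d ^ 2 + 3 * d) * b      ∎
  where open ℕ.≤-Reasoning

theorem1p2 : (n : ℕ) (G : Graph n) →
    let Δ = maxDegree G
        H = lineGraph G
    in
    3 ≤ Δ →
    ∃[ b ] ( IsBoxicity (complement H) b
           × b ≤ n ∸ 2
           × (Δ ≡ 3 → ∣E∣ H ≤ 12 * b)
           × (Δ ≡ 4 → ∣E∣ H ≤ 16 * b)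
           × (5 ≤ Δ → 2 * ∣E∣ H ≤ (Δ ^ 2 + 3 * Δ) * b))
theorem1p2 n G _ =
  let b , isBoxicity , b≤n∸2 , rep = Boxicity.boxicity (complement (lineGraph G)) (box-n∸2 n G)
  in b , isBoxicity , b≤n∸2 ,
     explicit-bounds (≤-trans (atMost-edges G rep) (≤-reflexive (ℕ.*-comm b (pairBound (maxDegree G)))))
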